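{- Let $m=m(n)$ satisfy $0.98\binom{n}{2}\le m<\binom{n}{2}$, and let $G\sim\mathcal{G}(n,m)$ be a graph on $n$ vertices with exactly $m$ edges chosen uniformly at random. Then asymptotically almost surely (as $n\to\infty$) $G$ has a legal system.
   Context: Let $G=(V,E)$ be a finite simple graph. Subsets of $V$ are identified with elements of $\mathbb{Z}_2^{V}$ (group operation: symmetric difference), and $g$ acts on $S\subseteq V$ by $g(S)=g\,\triangle\, S$. A subset $S\subseteq V$ is a legal state if both $S$ and $V\setminus S$ are non-empty and induce connected subgraphs of $G$. For $v\in V$, a move at $v$ is a set $M_v\subseteq V$ with $v\in M_v$ and $M_v\cap N(v)=\emptyset$. Given moves $\mathcal{M}=\{M_v:v\in V\}$ and $S\subseteq V$, the triple $(G,S,\mathcal{M})$ is a legal system if $g(S)$ is a legal state for every $g\in\langle\mathcal{M}\rangle\le\mathbb{Z}_2^V$. $G$ has a legal system if such $S,\mathcal{M}$ exist. "Asymptotically almost surely" means with probability tending to $1$ as $n\to\infty$. -}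

module Defs where

open import Data.Nat using (ℕ; _≟_; _≤_; _<_; _*_; _∸_)
open import Data.Fin using (Fin) renaming (_<?_ to _<ᶠ?_)
open import Data.Fin.Subset using (Subset; _∈_; _∉_; ∁) renaming (⊥ to ∅)
open import Data.Bool using (_xor_)
open import Data.Vec using (zipWith)
open import Data.List using (List; []; _∷_; _++_; map; filter; length; cartesianProduct; allFin)
open import Data.List.Relation.Binary.Sublist.Propositional using () renaming (_⊆_ to _⊑_)
open import Data.List.Relation.Unary.All using (All)
import Data.List.Membership.Propositional as LM
open import Data.Product using (_×_; _,_; proj₁; proj₂; ∃; ∃-syntax)
open import Data.Sum using (_⊎_)

-- A finite simple graph on vertex set Fin n, given by its list of edges {i,j},
-- each edge stored once as the pair (i , j) with i < j.
Edges : ℕ → Set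
Edges n = List (Fin n × Fin n)

allPairs : (n : ℕ) → Edges n
allPairs n = filter (λ p → proj₁ p <ᶠ? proj₂ p) (cartesianProduct (allFin n) (allFin n))

sublists : {A : Set} → List A → List (List A)
sublists []       = [] ∷ []
sublists (x ∷ xs) = sublists xs ++ map (x ∷_) (sublists xs)

-- The sample space of G(n,m): all simple graphs on Fin n with exactly m edges
-- (each occurring exactly once in this list).
graphsWith : (n m : ℕ) → List (Edges n)
graphsWith n m = filter (λ E → length E ≟ m) (sublists (allPairs n))

Adj : {n : ℕ} → Edges n → Fin n → Fin n → Set
Adj E u v = (u , v) LM.∈ E ⊎ (v , u) LM.∈ E

_△_ : {n : ℕ} → Subset n → Subset n → Subset n
_△_ = zipWith _xor_

data WalkIn {n : ℕ} (E : Edges n) (S : Subset n) : Fin n → Fin n → Set where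
  here : ∀ {u} → u ∈ S → WalkIn E S u u
  step : ∀ {u w v} → u ∈ S → Adj E u w → WalkIn E S w v → WalkIn E S u v

ConnectedNonempty : {n : ℕ} → Edges n → Subset n → Set
ConnectedNonempty E S = (∃[ v ] v ∈ S) × (∀ u v → u ∈ S → v ∈ S → WalkIn E S u v)

LegalState : {n : ℕ} → Edges n → Subset n → Set
LegalState E S = ConnectedNonempty E S × ConnectedNonempty E (∁ S)

IsMoves : {n : ℕ} → Edges n → (Fin n → Subset n) → Set
IsMoves E M = ∀ v → (v ∈ M v) × (∀ w → Adj E v w → w ∉ M v)

data InSpan {n : ℕ} (M : Fin n → Subset n) : Subset n → Set where
  zero : InSpan M ∅
  add  : ∀ v {g} → InSpan M g → InSpan M (M v △ g)

HasLegalSystem : {n : ℕ} → Edges n → Set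
HasLegalSystem E = ∃[ S ] ∃[ M ] (IsMoves E M × (∀ g → InSpan M g → LegalState E (g △ S)))

{-# OPTIONS --safe #-}
-- Let H be the complement of G, with e edges and maximum degree D.  Take pairwise
-- disjoint edges of H; let M v be the matching edge containing v, or {v} if there is
-- none, and let S pick one end of every matching edge.  Every g ∈ ⟨M⟩ contains both or
-- neither end of a matching edge, so g △ S and its complement are transversals of the
-- matching.  A transversal is connected in G as soon as any two vertices u, v have a
-- common matching edge {a, b} such that each of u, v either lies on {a, b} or is
-- G-adjacent to both a and b.
--
-- If D ≤ 1, a single edge of H is such a matching.  If D ≤ Δ and e > 4 Δ (Δ + 1), greedy
-- choice gives 2Δ + 3 disjoint edges, while u, v and their H-neighbours meet at most
-- 2Δ + 2 of them.
--
-- Degrees are controlled by E[deg_H(v) choose t] = C(n-1,t) C(N-t,m) / C(N,m), N = C(n,2),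
-- and Markov's inequality.  With b ≈ n^(1/9), t = 2 gives D ≤ 1 w.h.p. when e ≤ 40000 b².
-- Otherwise take Δ maximal with 4 Δ (Δ + 1) < e; then Δ + 1 ≥ 100 b, and t = 10 b + 1
-- gives D ≤ Δ w.h.p., because Δ is a constant factor above 2e/n thanks to e ≤ N/50.
module Submission where

open import Defs
open import Data.Bool.Base using (true; false; not; _xor_)
open import Data.Fin using (Fin; zero; suc) renaming (_<?_ to _<ᶠ?_; _<_ to _<ᶠ_)
import Data.Fin.Properties as Fin
open import Data.Fin.Subset using (Subset; ∁) renaming (_∈_ to _∈ˢ_)
open import Data.List using (List; []; _∷_; _++_; map; filter; length; allFin; cartesianProduct)
open import Data.List.Membership.Propositional using (_∈_; _∉_; find)
open import Data.List.Membership.Propositional.Properties using (∈-++⁺ʳ; ∈-++⁺ˡ; ∈-++⁻; ∈-allFin;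
  ∈-cartesianProduct⁺; ∈-filter⁺; ∈-filter⁻; ∈-map⁺; ∈-map⁻)
open import Data.List.Properties using (++-identityʳ; filter-++; filter-accept; filter-all;
  filter-none; filter-reject; length-++; length-filter; length-map; length-tabulate; map-++;
  map-cong; map-tabulate; map-∘)
open import Data.List.Relation.Binary.Sublist.Propositional using (_⊆_; []; _∷_; _∷ʳ_; lookup)
open import Data.List.Relation.Binary.Sublist.Propositional.Properties using (filter-⊆)
open import Data.List.Relation.Unary.All using (All; []; _∷_)
import Data.List.Relation.Unary.All as All
import Data.List.Relation.Unary.All.Properties as All
open import Data.List.Relation.Unary.AllPairs using (AllPairs; []; _∷_)
import Data.List.Relation.Unary.AllPairs.Properties as AllPairs
open import Data.List.Relation.Unary.Any using (Any; here; there; any?)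
import Data.List.Relation.Unary.Any as Any
open import Data.List.Relation.Unary.Unique.Propositional using (Unique)
import Data.List.Relation.Unary.Unique.Propositional.Properties as Unique
open import Data.Nat using (ℕ; zero; suc; pred; z≤n; s≤s; s≤s⁻¹; _+_; _*_; _∸_; _^_; _≤_; _<_; _≟_;
  _≤?_; _<?_; _≡ᵇ_; NonZero; >-nonZero; >-nonZero⁻¹; ≢-nonZero)
open import Data.Nat.Combinatorics using (_C_; nCk+nC[k+1]≡[n+1]C[k+1]; k>n⇒nCk≡0; nC1≡n)
open import Data.Nat.ListAction using (sum)
open import Data.Nat.ListAction.Properties using (sum-++)
open import Data.Nat.Properties
open import Data.Nat.Tactic.RingSolver using (solve-∀)
open import Data.Product using (_×_; _,_; proj₁; proj₂; ∃-syntax)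
open import Data.Sum using (_⊎_; inj₁; inj₂)
import Data.Sum as Sum
import Data.Vec as Vec
import Data.Vec.Properties as Vec
open import Function using (id; _∘_; mk⇔)
open import Level using (0ℓ)
open import Relation.Binary using (tri<; tri≈; tri>)
open import Relation.Binary.PropositionalEquality
open import Relation.Nullary using (yes; no; ¬_; ¬?; contradiction; does; _⊎-dec_; _×-dec_)
open import Relation.Nullary.Decidable using (does-⇔; dec-true; dec-false)
open import Relation.Unary using (Pred; Decidable)

-- Binomial coefficients

C-mono : ∀ t {a b} → a ≤ b → a C t ≤ b C t
C-mono zero _ = ≤-refl
C-mono (suc t) {b = b} z≤n = z≤n
C-mono (suc t) (s≤s {a} {b} a≤b) = begin
  suc a C suc t       ≡⟨ nCk+nC[k+1]≡[n+1]C[k+1] a t ⟨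
  a C t + a C suc t   ≤⟨ +-mono-≤ (C-mono t a≤b) (C-mono (suc t) a≤b) ⟩
  b C t + b C suc t   ≡⟨ nCk+nC[k+1]≡[n+1]C[k+1] b t ⟩
  suc b C suc t       ∎
  where open ≤-Reasoning

0<nCk : ∀ {n k} → k ≤ n → 0 < n C k
0<nCk z≤n = s≤s z≤n
0<nCk (s≤s {k} {n} k≤n) = begin-strict
  0                   <⟨ 0<nCk k≤n ⟩
  n C k               ≤⟨ m≤m+n _ _ ⟩
  n C k + n C suc k   ≡⟨ nCk+nC[k+1]≡[n+1]C[k+1] n k ⟩
  suc n C suc k       ∎
  where open ≤-Reasoning

absorption : ∀ n k → suc k * (suc n C suc k) ≡ suc n * (n C k)
absorption n zero = begin
  1 * (suc n C 1)   ≡⟨ *-identityˡ _ ⟩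
  suc n C 1         ≡⟨ nC1≡n (suc n) ⟩
  suc n             ≡⟨ *-identityʳ (suc n) ⟨
  suc n * 1         ∎
  where open ≡-Reasoning
absorption zero (suc k) = *-zeroʳ k
absorption (suc n) (suc k) = begin
  suc (suc k) * (suc (suc n) C suc (suc k))
    ≡⟨ cong (suc (suc k) *_) (nCk+nC[k+1]≡[n+1]C[k+1] (suc n) (suc k)) ⟨
  suc (suc k) * (X + suc n C suc (suc k))
    ≡⟨ *-distribˡ-+ (suc (suc k)) X _ ⟩
  suc (suc k) * X + suc (suc k) * (suc n C suc (suc k))
    ≡⟨ cong (X + suc k * X +_) (absorption n (suc k)) ⟩
  X + suc k * X + suc n * (n C suc k)
    ≡⟨ cong (λ z → X + z + suc n * (n C suc k)) (absorption n k) ⟩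
  X + suc n * (n C k) + suc n * (n C suc k)
    ≡⟨ +-assoc X _ _ ⟩
  X + (suc n * (n C k) + suc n * (n C suc k))
    ≡⟨ cong (X +_) (*-distribˡ-+ (suc n) (n C k) (n C suc k)) ⟨
  X + suc n * (n C k + n C suc k)
    ≡⟨ cong (λ z → X + suc n * z) (nCk+nC[k+1]≡[n+1]C[k+1] n k) ⟩
  X + suc n * X ∎
  where
  open ≡-Reasoning
  X = suc n C suc k

-- Once `k * (suc n C k)` is added to both sides, absorption and Pascal's rule turn each into
-- `suc n * (suc n C k)`. For `k` at or beyond the upper index both sides vanish, the right one by
-- truncation.
C-sucʳ : ∀ n k → suc k * (n C suc k) ≡ (n ∸ k) * (n C k)
C-sucʳ zero zero = refl
C-sucʳ zero (suc k) = *-zeroʳ k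
C-sucʳ (suc n) k with k ≤? n
... | no k≰n = begin
  suc k * (suc n C suc k)  ≡⟨ cong (suc k *_) (k>n⇒nCk≡0 (s≤s (≰⇒> k≰n))) ⟩
  suc k * 0                ≡⟨ *-zeroʳ (suc k) ⟩
  0 * (suc n C k)          ≡⟨ cong (_* (suc n C k)) (m≤n⇒m∸n≡0 (≰⇒> k≰n)) ⟨
  (suc n ∸ k) * (suc n C k) ∎
  where open ≡-Reasoning
... | yes k≤n = +-cancelˡ-≡ (k * (suc n C k)) _ _ (begin
  k * (suc n C k) + suc k * (suc n C suc k) ≡⟨ cong₂ _+_ (k-absorb k) (absorption n k) ⟩
  suc n * nC[ k -1] + suc n * (n C k)     ≡⟨ *-distribˡ-+ (suc n) nC[ k -1] (n C k) ⟨
  suc n * (nC[ k -1] + n C k)             ≡⟨ cong (suc n *_) (pascal k) ⟩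
  suc n * (suc n C k)                        ≡⟨ cong (_* (suc n C k)) (m+[n∸m]≡n {k} (m≤n⇒m≤1+n k≤n)) ⟨
  (k + (suc n ∸ k)) * (suc n C k)            ≡⟨ *-distribʳ-+ (suc n C k) k (suc n ∸ k) ⟩
  k * (suc n C k) + (suc n ∸ k) * (suc n C k) ∎)
  where
  open ≡-Reasoning
  -- C(n, k-1) with value 0 at `k = 0`, so that absorption and Pascal's rule cover that case too.
  nC[_-1] : ℕ → ℕ
  nC[ zero -1] = 0
  nC[ suc j -1] = n C j
  k-absorb : ∀ k → k * (suc n C k) ≡ suc n * nC[ k -1]
  k-absorb zero = sym (*-zeroʳ (suc n))
  k-absorb (suc j) = absorption n j
  pascal : ∀ k → nC[ k -1] + n C k ≡ suc n C k
  pascal zero = refl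
  pascal (suc j) = nCk+nC[k+1]≡[n+1]C[k+1] n j

C-sucˡ : ∀ n k → suc n * (n C k) ≡ (suc n ∸ k) * (suc n C k)
C-sucˡ n k = trans (sym (absorption n k)) (C-sucʳ (suc n) k)

-- The cross-multiplied form of (q - i)/(N - i) ≤ q/N. It bounds each ratio in the moment recursion
-- by the first one.
∸-cross : ∀ i {q N} → q ≤ N → (q ∸ i) * N ≤ q * (N ∸ i)
∸-cross i {q} {N} q≤N = begin
  (q ∸ i) * N     ≡⟨ *-distribʳ-∸ N q i ⟩
  q * N ∸ i * N   ≤⟨ ∸-monoʳ-≤ (q * N) (*-monoʳ-≤ i q≤N) ⟩
  q * N ∸ i * q   ≡⟨ cong (q * N ∸_) (*-comm i q) ⟩
  q * N ∸ q * i   ≡⟨ *-distribˡ-∸ q N i ⟨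
  q * (N ∸ i)     ∎
  where open ≤-Reasoning

-- Passing from t to suc t multiplies the two sides by r (q - t) (N - m - t) and (x - t) (N - t),
-- where x = y + t', up to a common factor; x - t ≥ y since t ≤ t'.
moment-ratio : ∀ {r q y N} m t' → q ≤ N → r * q * (N ∸ m) ≤ y * N → ∀ t → t ≤ suc t' →
  r ^ t * ((q C t) * ((N ∸ t) C m)) ≤ ((y + t') C t) * (N C m)
moment-ratio {r} {q} {y} {N} m t' q≤N h zero _ = ≤-reflexive (*-identityˡ (1 * (N C m)))
moment-ratio {r} {q} {y} {N} m t' q≤N h (suc t) (s≤s t≤t') with t <? N
-- Here `suc t` exceeds `N`, hence `q`, so the binomial in `q` vanishes.
... | no t≮N = begin
  r ^ suc t * ((q C suc t) * ((N ∸ suc t) C m))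
    ≡⟨ cong (λ z → r ^ suc t * (z * _)) (k>n⇒nCk≡0 (s≤s (≤-trans q≤N (≮⇒≥ t≮N)))) ⟩
  r ^ suc t * 0  ≡⟨ *-zeroʳ (r ^ suc t) ⟩
  0              ≤⟨ z≤n ⟩
  _              ∎
  where open ≤-Reasoning
-- `suc t` and `suc a`, which is N - t, are the denominators in the recurrences `C-sucʳ` and
-- `C-sucˡ`.
... | yes t<N = *-cancelˡ-≤ (suc t * suc a) (begin
  suc t * suc a * (r ^ suc t * ((q C suc t) * (a C m)))
    ≡⟨ permute₁ (suc t) (suc a) r (r ^ t) (q C suc t) (a C m) ⟩
  r ^ t * r * (suc t * (q C suc t)) * (suc a * (a C m))
    ≡⟨ cong₂ (λ u v → r ^ t * r * u * v) (C-sucʳ q t) (C-sucˡ a m) ⟩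
  r ^ t * r * ((q ∸ t) * (q C t)) * ((suc a ∸ m) * (suc a C m))
    ≡⟨ permute₂ (r ^ t) r (q ∸ t) (q C t) (suc a ∸ m) (suc a C m) ⟩
  r * (q ∸ t) * (suc a ∸ m) * (r ^ t * ((q C t) * (suc a C m)))
    ≤⟨ *-mono-≤ factor (subst (λ z → r ^ t * ((q C t) * (z C m)) ≤ (x C t) * (N C m)) N∸t (moment-ratio m t' q≤N h t (m≤n⇒m≤1+n t≤t'))) ⟩
  (x ∸ t) * suc a * ((x C t) * (N C m))
    ≡⟨ permute₃ (x ∸ t) (suc a) (x C t) (N C m) ⟩
  suc a * ((x ∸ t) * (x C t)) * (N C m)
    ≡⟨ cong (λ z → suc a * z * (N C m)) (C-sucʳ x t) ⟨
  suc a * (suc t * (x C suc t)) * (N C m)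
    ≡⟨ permute₄ (suc a) (suc t) (x C suc t) (N C m) ⟩
  suc t * suc a * ((x C suc t) * (N C m)) ∎)
  where
  open ≤-Reasoning
  a = N ∸ suc t
  x = y + t'
  N∸t : N ∸ t ≡ suc a
  N∸t = +-∸-assoc 1 t<N
  y≤x∸t : y ≤ x ∸ t
  y≤x∸t = begin
    y               ≡⟨ m+n∸n≡m y t ⟨
    y + t ∸ t       ≤⟨ ∸-monoˡ-≤ t (+-monoʳ-≤ y t≤t') ⟩
    x ∸ t           ∎
  instance
    N≢0 : NonZero N
    N≢0 = >-nonZero (≤-<-trans z≤n t<N)
  rearrange₀ : ∀ a b c d → a * b * c * d ≡ a * c * (b * d)
  rearrange₀ = solve-∀
  rearrange₁ : ∀ a b c d → a * b * (c * d) ≡ a * c * b * d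
  rearrange₁ = solve-∀
  rearrange₂ : ∀ a b c → a * b * c ≡ a * c * b
  rearrange₂ = solve-∀
  -- After multiplying by `N`, `∸-cross` trades (q - t) N for q (N - t), which exposes the left side
  -- of `h`.
  factor : r * (q ∸ t) * (suc a ∸ m) ≤ (x ∸ t) * suc a
  factor = *-cancelʳ-≤ _ _ N (begin
    r * (q ∸ t) * (suc a ∸ m) * N    ≡⟨ rearrange₀ r (q ∸ t) (suc a ∸ m) N ⟩
    r * (suc a ∸ m) * ((q ∸ t) * N)  ≤⟨ *-mono-≤ (*-monoʳ-≤ r (∸-monoˡ-≤ m (≤-trans (≤-reflexive (sym N∸t)) (m∸n≤m N t)))) (∸-cross t q≤N) ⟩
    r * (N ∸ m) * (q * (N ∸ t))      ≡⟨ rearrange₁ r (N ∸ m) q (N ∸ t) ⟩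
    r * q * (N ∸ m) * (N ∸ t)        ≤⟨ *-mono-≤ h (≤-reflexive N∸t) ⟩
    y * N * suc a                    ≤⟨ *-monoˡ-≤ (suc a) (*-monoˡ-≤ N y≤x∸t) ⟩
    (x ∸ t) * N * suc a              ≡⟨ rearrange₂ (x ∸ t) N (suc a) ⟩
    (x ∸ t) * suc a * N              ∎)
  permute₁ : ∀ T A r R B D → T * A * (r * R * (B * D)) ≡ R * r * (T * B) * (A * D)
  permute₁ = solve-∀
  permute₂ : ∀ R r u B w D → R * r * (u * B) * (w * D) ≡ r * u * w * (R * (B * D))
  permute₂ = solve-∀
  permute₃ : ∀ u A B D → u * A * (B * D) ≡ A * (u * B) * D
  permute₃ = solve-∀
  permute₄ : ∀ A T B D → A * (T * B) * D ≡ T * A * (B * D)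
  permute₄ = solve-∀

-- Counting sublists of a given length

sum-map-mono : {A : Set} {f g : A → ℕ} → (∀ x → f x ≤ g x) → ∀ xs → sum (map f xs) ≤ sum (map g xs)
sum-map-mono f≤g [] = z≤n
sum-map-mono f≤g (x ∷ xs) = +-mono-≤ (f≤g x) (sum-map-mono f≤g xs)

sum-map-+ : {A : Set} (f g : A → ℕ) → ∀ xs → sum (map (λ x → f x + g x) xs) ≡ sum (map f xs) + sum (map g xs)
sum-map-+ f g [] = refl
sum-map-+ f g (x ∷ xs) = trans (cong (f x + g x +_) (sum-map-+ f g xs)) (interchange (f x) (g x) _ _)
  where
  interchange : ∀ a b c d → a + b + (c + d) ≡ a + c + (b + d)
  interchange = solve-∀

∈⇒≤sum : {A : Set} (f : A → ℕ) {x : A} {xs : List A} → x ∈ xs → f x ≤ sum (map f xs)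
∈⇒≤sum f (here refl) = m≤m+n _ _
∈⇒≤sum f (there x∈xs) = ≤-trans (∈⇒≤sum f x∈xs) (m≤n+m _ _)

-- Interchange of summation, one `v` at a time; this is the union bound in counting form.
sum-sum-≤ : {A V : Set} (f : V → A → ℕ) (B : ℕ) (xs : List A) →
  (∀ v → sum (map (f v) xs) ≤ B) → ∀ vs →
  sum (map (λ x → sum (map (λ v → f v x) vs)) xs) ≤ length vs * B
sum-sum-≤ f B xs h [] = ≤-reflexive (sum-zeros xs)
  where
  sum-zeros : {A : Set} (xs : List A) → sum (map (λ _ → 0) xs) ≡ 0
  sum-zeros [] = refl
  sum-zeros (_ ∷ xs) = sum-zeros xs
sum-sum-≤ f B xs h (v ∷ vs) = begin
  sum (map (λ x → f v x + sum (map (λ v → f v x) vs)) xs)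
    ≡⟨ sum-map-+ (f v) _ xs ⟩
  sum (map (f v) xs) + sum (map (λ x → sum (map (λ v → f v x) vs)) xs)
    ≤⟨ +-mono-≤ (h v) (sum-sum-≤ f B xs h vs) ⟩
  B + length vs * B ∎
  where open ≤-Reasoning

-- `graphsWith n m` is by definition the case `L = allPairs n`; a general `L` permits induction.
sublistsOfLength : {A : Set} → List A → ℕ → List (List A)
sublistsOfLength L m = filter (λ E → length E ≟ m) (sublists L)

filter-length-map-∷ : {A : Set} (x : A) (m : ℕ) (Es : List (List A)) →
  filter (λ E → length E ≟ suc m) (map (x ∷_) Es) ≡ map (x ∷_) (filter (λ E → length E ≟ m) Es)
filter-length-map-∷ x m [] = refl
-- The decision `suc (length E) ≟ suc m` also computes to `length E ≡ᵇ m`, so one split reduces both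
-- filters.
filter-length-map-∷ x m (E ∷ Es) with length E ≡ᵇ m
... | true = cong (_ ∷_) (filter-length-map-∷ x m Es)
... | false = filter-length-map-∷ x m Es

filter-length-zero-map-∷ : {A : Set} (x : A) (Es : List (List A)) →
  filter (λ E → length E ≟ 0) (map (x ∷_) Es) ≡ []
filter-length-zero-map-∷ x [] = refl
filter-length-zero-map-∷ x (E ∷ Es) = filter-length-zero-map-∷ x Es

sublistsOfLength-∷-zero : {A : Set} (x : A) (L : List A) →
  sublistsOfLength (x ∷ L) 0 ≡ sublistsOfLength L 0
sublistsOfLength-∷-zero x L = begin
  filter Z (sublists L ++ map (x ∷_) (sublists L))           ≡⟨ filter-++ Z (sublists L) _ ⟩
  filter Z (sublists L) ++ filter Z (map (x ∷_) (sublists L)) ≡⟨ cong (filter Z (sublists L) ++_) (filter-length-zero-map-∷ x (sublists L)) ⟩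
  filter Z (sublists L) ++ []                                ≡⟨ ++-identityʳ _ ⟩
  filter Z (sublists L) ∎
  where
  open ≡-Reasoning
  Z = λ E → length E ≟ 0

-- Pascal's rule for lists: first the sublists omitting `x`, then those containing it. Counts and
-- moments both follow this recurrence.
sublistsOfLength-∷-suc : {A : Set} (x : A) (L : List A) (m : ℕ) →
  sublistsOfLength (x ∷ L) (suc m) ≡ sublistsOfLength L (suc m) ++ map (x ∷_) (sublistsOfLength L m)
sublistsOfLength-∷-suc x L m = trans
  (filter-++ (λ E → length E ≟ suc m) (sublists L) _)
  (cong (sublistsOfLength L (suc m) ++_) (filter-length-map-∷ x m (sublists L)))

length-sublistsOfLength : {A : Set} (L : List A) (m : ℕ) → length (sublistsOfLength L m) ≡ length L C m
length-sublistsOfLength [] zero = refl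
length-sublistsOfLength [] (suc m) = refl
length-sublistsOfLength (x ∷ L) zero = trans
  (cong length (sublistsOfLength-∷-zero x L)) (length-sublistsOfLength L 0)
length-sublistsOfLength (x ∷ L) (suc m) = begin
  length (sublistsOfLength (x ∷ L) (suc m))
    ≡⟨ cong length (sublistsOfLength-∷-suc x L m) ⟩
  length (sublistsOfLength L (suc m) ++ map (x ∷_) (sublistsOfLength L m))
    ≡⟨ length-++ (sublistsOfLength L (suc m)) ⟩
  length (sublistsOfLength L (suc m)) + length (map (x ∷_) (sublistsOfLength L m))
    ≡⟨ cong (length (sublistsOfLength L (suc m)) +_) (length-map (x ∷_) (sublistsOfLength L m)) ⟩
  length (sublistsOfLength L (suc m)) + length (sublistsOfLength L m)
    ≡⟨ cong₂ _+_ (length-sublistsOfLength L (suc m)) (length-sublistsOfLength L m) ⟩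
  length L C suc m + length L C m
    ≡⟨ +-comm (length L C suc m) _ ⟩
  length L C m + length L C suc m
    ≡⟨ nCk+nC[k+1]≡[n+1]C[k+1] (length L) m ⟩
  suc (length L) C suc m ∎
  where open ≡-Reasoning

sum-sublistsOfLength-∷ : {A : Set} (f : List A → ℕ) (x : A) (L : List A) (m : ℕ) →
  sum (map f (sublistsOfLength (x ∷ L) (suc m)))
    ≡ sum (map f (sublistsOfLength L (suc m))) + sum (map (λ E → f (x ∷ E)) (sublistsOfLength L m))
sum-sublistsOfLength-∷ f x L m = begin
  sum (map f (sublistsOfLength (x ∷ L) (suc m)))
    ≡⟨ cong (λ Es → sum (map f Es)) (sublistsOfLength-∷-suc x L m) ⟩
  sum (map f (G ++ map (x ∷_) H))
    ≡⟨ cong sum (map-++ f G _) ⟩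
  sum (map f G ++ map f (map (x ∷_) H))
    ≡⟨ sum-++ (map f G) _ ⟩
  sum (map f G) + sum (map f (map (x ∷_) H))
    ≡⟨ cong (λ z → sum (map f G) + sum z) (map-∘ H) ⟨
  sum (map f G) + sum (map (λ E → f (x ∷ E)) H) ∎
  where
  open ≡-Reasoning
  G = sublistsOfLength L (suc m)
  H = sublistsOfLength L m

-- Binomial moments of the number of missing elements

module _ {A : Set} {P : Pred A 0ℓ} (P? : Decidable P) where

  count : List A → ℕ
  count xs = length (filter P? xs)

  -- For E ⊆ L, the truncated difference is the number of elements of L satisfying P missing from E.
  binomialMoment : List A → ℕ → ℕ → ℕ
  binomialMoment L m t = sum (map (λ E → (count L ∸ count E) C t) (sublistsOfLength L m))

  private
    -- The double count behind the moment: choose `t` missing elements satisfying `P`, then the `m`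
    -- elements of `E` among the rest.
    bound : List A → ℕ → ℕ → ℕ
    bound L m t = (count L C t) * ((length L ∸ t) C m)

    -- Pascal's rule in the second factor while `t ≤ length L`; beyond that, `count L C t` is zero.
    bound-∷ : ∀ L m t → bound L (suc m) t + bound L m t ≤ (count L C t) * ((suc (length L) ∸ t) C suc m)
    bound-∷ L m t with t ≤? length L
    ... | yes t≤N = ≤-reflexive (begin
      b * ((N ∸ t) C suc m) + b * ((N ∸ t) C m) ≡⟨ *-distribˡ-+ b _ _ ⟨
      b * ((N ∸ t) C suc m + (N ∸ t) C m)       ≡⟨ cong (b *_) (+-comm ((N ∸ t) C suc m) _) ⟩
      b * ((N ∸ t) C m + (N ∸ t) C suc m)       ≡⟨ cong (b *_) (nCk+nC[k+1]≡[n+1]C[k+1] (N ∸ t) m) ⟩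
      b * (suc (N ∸ t) C suc m)                 ≡⟨ cong (λ z → b * (z C suc m)) (+-∸-assoc 1 t≤N) ⟨
      b * ((suc N ∸ t) C suc m)                 ∎)
      where
      open ≡-Reasoning
      b = count L C t
      N = length L
    ... | no t≰N rewrite k>n⇒nCk≡0 (≤-<-trans (length-filter P? L) (≰⇒> t≰N)) = z≤n

    -- Omitting a new element with `P` raises the deficit by one, and Pascal's rule splits its
    -- binomial. As an inequality this survives truncated subtraction, without carrying a proof of
    -- `E ⊆ L`.
    omit-≤ : ∀ L m t →
      sum (map (λ E → (suc (count L) ∸ count E) C suc t) (sublistsOfLength L m))
        ≤ binomialMoment L m t + binomialMoment L m (suc t)
    omit-≤ L m t = begin
      sum (map (λ E → (suc (count L) ∸ count E) C suc t) (sublistsOfLength L m))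
        ≤⟨ sum-map-mono (λ E → pascal-≤ (count E)) (sublistsOfLength L m) ⟩
      sum (map (λ E → (count L ∸ count E) C t + (count L ∸ count E) C suc t) (sublistsOfLength L m))
        ≡⟨ sum-map-+ _ _ (sublistsOfLength L m) ⟩
      binomialMoment L m t + binomialMoment L m (suc t) ∎
      where
      open ≤-Reasoning
      suc-∸-≤ : ∀ a b → suc a ∸ b ≤ suc (a ∸ b)
      suc-∸-≤ a zero = ≤-refl
      suc-∸-≤ zero (suc b) = ≤-trans (m∸n≤m 0 b) z≤n
      suc-∸-≤ (suc a) (suc b) = suc-∸-≤ a b
      pascal-≤ : ∀ b → (suc (count L) ∸ b) C suc t ≤ (count L ∸ b) C t + (count L ∸ b) C suc t
      pascal-≤ b = ≤-trans (C-mono (suc t) (suc-∸-≤ (count L) b))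
        (≤-reflexive (sym (nCk+nC[k+1]≡[n+1]C[k+1] (count L ∸ b) t)))

  -- Induction along the recurrence of `sublistsOfLength`. If `x` fails `P`, only the second factor
  -- of the bound changes. If `x` satisfies `P`, the sublists omitting it give the moments `t` and
  -- `suc t`, those containing it give moment `suc t` with one element fewer to choose, and Pascal's
  -- rule recombines both factors.
  binomialMoment-≤ : ∀ L m t → binomialMoment L m t ≤ (count L C t) * ((length L ∸ t) C m)
  binomialMoment-≤ [] zero t = ≤-reflexive (trans (+-identityʳ _) (sym (*-identityʳ _)))
  binomialMoment-≤ [] (suc m) t = z≤n
  binomialMoment-≤ (x ∷ L) m t with P? x
  binomialMoment-≤ (x ∷ L) zero t | no ¬px = begin
    sum (map (λ E → (count L ∸ count E) C t) (sublistsOfLength (x ∷ L) 0))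
      ≡⟨ cong (λ Es → sum (map (λ E → (count L ∸ count E) C t) Es)) (sublistsOfLength-∷-zero x L) ⟩
    binomialMoment L 0 t
      ≤⟨ binomialMoment-≤ L 0 t ⟩
    (count L C t) * 1 ∎
    where open ≤-Reasoning
  binomialMoment-≤ (x ∷ L) (suc m) t | no ¬px = begin
    sum (map (λ E → (count L ∸ count E) C t) (sublistsOfLength (x ∷ L) (suc m)))
      ≡⟨ sum-sublistsOfLength-∷ _ x L m ⟩
    binomialMoment L (suc m) t + sum (map (λ E → (count L ∸ count (x ∷ E)) C t) (sublistsOfLength L m))
      ≡⟨ cong (λ z → binomialMoment L (suc m) t + sum z)
           (map-cong (λ E → cong (λ ys → (count L ∸ length ys) C t) (filter-reject P? ¬px)) (sublistsOfLength L m)) ⟩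
    binomialMoment L (suc m) t + binomialMoment L m t
      ≤⟨ +-mono-≤ (binomialMoment-≤ L (suc m) t) (binomialMoment-≤ L m t) ⟩
    bound L (suc m) t + bound L m t
      ≤⟨ bound-∷ L m t ⟩
    (count L C t) * ((suc (length L) ∸ t) C suc m) ∎
    where open ≤-Reasoning
  binomialMoment-≤ (x ∷ L) zero zero | yes px = begin
    sum (map (λ E → 1) (sublistsOfLength (x ∷ L) 0))
      ≡⟨ cong (λ Es → sum (map (λ E → 1) Es)) (sublistsOfLength-∷-zero x L) ⟩
    binomialMoment L 0 0
      ≤⟨ binomialMoment-≤ L 0 0 ⟩
    1 ∎
    where open ≤-Reasoning
  binomialMoment-≤ (x ∷ L) (suc m) zero | yes px = begin
    sum (map (λ E → 1) (sublistsOfLength (x ∷ L) (suc m)))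
      ≡⟨ sum-sublistsOfLength-∷ _ x L m ⟩
    binomialMoment L (suc m) 0 + binomialMoment L m 0
      ≤⟨ +-mono-≤ (binomialMoment-≤ L (suc m) 0) (binomialMoment-≤ L m 0) ⟩
    bound L (suc m) 0 + bound L m 0
      ≤⟨ bound-∷ L m 0 ⟩
    1 * (suc (length L) C suc m) ∎
    where open ≤-Reasoning
  binomialMoment-≤ (x ∷ L) zero (suc t) | yes px = begin
    sum (map (λ E → (suc (count L) ∸ count E) C suc t) (sublistsOfLength (x ∷ L) 0))
      ≡⟨ cong (λ Es → sum (map (λ E → (suc (count L) ∸ count E) C suc t) Es)) (sublistsOfLength-∷-zero x L) ⟩
    sum (map (λ E → (suc (count L) ∸ count E) C suc t) (sublistsOfLength L 0))
      ≤⟨ omit-≤ L 0 t ⟩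
    binomialMoment L 0 t + binomialMoment L 0 (suc t)
      ≤⟨ +-mono-≤ (binomialMoment-≤ L 0 t) (binomialMoment-≤ L 0 (suc t)) ⟩
    (count L C t) * 1 + (count L C suc t) * 1
      ≡⟨ *-distribʳ-+ 1 (count L C t) _ ⟨
    (count L C t + count L C suc t) * 1
      ≡⟨ cong (_* 1) (nCk+nC[k+1]≡[n+1]C[k+1] (count L) t) ⟩
    (suc (count L) C suc t) * 1 ∎
    where open ≤-Reasoning
  binomialMoment-≤ (x ∷ L) (suc m) (suc t) | yes px = begin
    sum (map (λ E → (suc (count L) ∸ count E) C suc t) (sublistsOfLength (x ∷ L) (suc m)))
      ≡⟨ sum-sublistsOfLength-∷ _ x L m ⟩
    sum (map (λ E → (suc (count L) ∸ count E) C suc t) (sublistsOfLength L (suc m)))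
      + sum (map (λ E → (suc (count L) ∸ count (x ∷ E)) C suc t) (sublistsOfLength L m))
      ≤⟨ +-monoˡ-≤ _ (omit-≤ L (suc m) t) ⟩
    binomialMoment L (suc m) t + binomialMoment L (suc m) (suc t)
      + sum (map (λ E → (suc (count L) ∸ count (x ∷ E)) C suc t) (sublistsOfLength L m))
      -- Including `x` adds one to both counts, so the deficit stays the same.
      ≡⟨ cong (λ z → binomialMoment L (suc m) t + binomialMoment L (suc m) (suc t) + sum z)
           (map-cong (λ E → cong (λ ys → (suc (count L) ∸ length ys) C suc t) (filter-accept P? px)) (sublistsOfLength L m)) ⟩
    binomialMoment L (suc m) t + binomialMoment L (suc m) (suc t) + binomialMoment L m (suc t)
      ≡⟨ +-assoc (binomialMoment L (suc m) t) _ _ ⟩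
    binomialMoment L (suc m) t + (binomialMoment L (suc m) (suc t) + binomialMoment L m (suc t))
      ≤⟨ +-mono-≤ (binomialMoment-≤ L (suc m) t)
           (+-mono-≤ (binomialMoment-≤ L (suc m) (suc t)) (binomialMoment-≤ L m (suc t))) ⟩
    bound L (suc m) t + (bound L (suc m) (suc t) + bound L m (suc t))
      ≤⟨ +-monoʳ-≤ (bound L (suc m) t) (bound-∷ L m (suc t)) ⟩
    (count L C t) * X + (count L C suc t) * X
      ≡⟨ *-distribʳ-+ X (count L C t) _ ⟨
    (count L C t + count L C suc t) * X
      ≡⟨ cong (_* X) (nCk+nC[k+1]≡[n+1]C[k+1] (count L) t) ⟩
    (suc (count L) C suc t) * X ∎
    where
    open ≤-Reasoning
    X = (length L ∸ t) C suc m

-- Markov's inequality and the union bound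

markov-union : {n : ℕ} {X : Set} (d : Fin n → X → ℕ) (x t B : ℕ) (xs : List X)
  (good? : Decidable (λ E → ∀ v → d v E < x)) →
  (∀ v → sum (map (λ E → d v E C t) xs) ≤ B) →
  (x C t) * (length xs ∸ length (filter good? xs)) ≤ n * B
markov-union {n} d x t B xs good? h = begin
  c * (length xs ∸ length (filter good? xs))        ≡⟨ *-distribˡ-∸ c (length xs) _ ⟩
  c * length xs ∸ c * length (filter good? xs)      ≤⟨ m≤n+o⇒m∸n≤o _ _ (markov xs) ⟩
  sum (map total xs)                                ≤⟨ sum-sum-≤ (λ v E → d v E C t) B xs h (allFin n) ⟩
  length (allFin n) * B                             ≡⟨ cong (_* B) (length-tabulate {n = n} id) ⟩
  n * B                                             ∎
  where
  open ≤-Reasoning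
  c = x C t
  total = λ E → sum (map (λ v → d v E C t) (allFin n))
  -- An `E` that is not good has some `v` with `x ≤ d v E`, so it contributes at least `c` to the
  -- total. Stated with sums, the induction avoids truncated subtraction.
  markov : ∀ xs → c * length xs ≤ c * length (filter good? xs) + sum (map total xs)
  markov [] = ≤-trans (≤-reflexive (*-zeroʳ c)) z≤n
  markov (E ∷ xs) with good? E
  ... | yes _ = begin
    c * suc (length xs)                                              ≡⟨ *-suc c (length xs) ⟩
    c + c * length xs                                                ≤⟨ +-monoʳ-≤ c (markov xs) ⟩
    c + (c * length (filter good? xs) + sum (map total xs))          ≡⟨ +-assoc c _ _ ⟨
    c + c * length (filter good? xs) + sum (map total xs)            ≡⟨ cong (_+ sum (map total xs)) (*-suc c _) ⟨
    c * suc (length (filter good? xs)) + sum (map total xs)          ≤⟨ +-monoʳ-≤ (c * suc (length (filter good? xs))) (m≤n+m _ _) ⟩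
    c * suc (length (filter good? xs)) + (total E + sum (map total xs)) ∎
  ... | no bad with v , ¬d<x ← Fin.¬∀⟶∃¬ n _ (λ v → d v E <? x) bad = begin
    c * suc (length xs)                                              ≡⟨ *-suc c (length xs) ⟩
    c + c * length xs                                                ≤⟨ +-mono-≤ (C-mono t (≮⇒≥ ¬d<x)) (markov xs) ⟩
    d v E C t + (c * length (filter good? xs) + sum (map total xs))  ≤⟨ +-monoˡ-≤ _ (∈⇒≤sum (λ v → d v E C t) (∈-allFin v)) ⟩
    total E + (c * length (filter good? xs) + sum (map total xs))    ≡⟨ swap (total E) (c * length (filter good? xs)) _ ⟩
    c * length (filter good? xs) + (total E + sum (map total xs))    ∎
    where
    swap : ∀ a b c → a + (b + c) ≡ b + (a + c)
    swap = solve-∀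

-- The mean deficit at `v` is at most q (N - m) / N, and `y` is at least `r` times that. By
-- `moment-ratio`, Markov's inequality for the moment of order `suc t` bounds the bad fraction by n
-- / r^(t+1), hence by 1/k.
few-with-large-deficit : {n : ℕ} {A : Set} {P : Fin n → Pred A 0ℓ} (P? : ∀ v → Decidable (P v))
  (L : List A) (m r q y t k : ℕ) →
  (∀ v → count (P? v) L ≤ q) → q ≤ length L → 0 < y →
  r * q * (length L ∸ m) ≤ y * length L → k * n ≤ r ^ suc t →
  (good? : Decidable (λ E → ∀ v → count (P? v) L ∸ count (P? v) E < y + t)) →
  k * (length (sublistsOfLength L m) ∸ length (filter good? (sublistsOfLength L m)))
    ≤ length (sublistsOfLength L m)
few-with-large-deficit {n} P? L m r q y t k deg≤q q≤N 0<y h kn≤r good? = *-cancelˡ-≤ c (begin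
  c * (k * bad)          ≡⟨ swap c k bad ⟩
  k * (c * bad)          ≤⟨ *-monoʳ-≤ k (markov-union (λ v E → count (P? v) L ∸ count (P? v) E) (y + t) (suc t) B G good? moment≤B) ⟩
  k * (n * B)            ≡⟨ *-assoc k n B ⟨
  k * n * B              ≤⟨ *-monoˡ-≤ B kn≤r ⟩
  r ^ suc t * B          ≤⟨ moment-ratio {r} {q} {y} m t q≤N h (suc t) ≤-refl ⟩
  c * (length L C m)     ≡⟨ cong (c *_) (length-sublistsOfLength L m) ⟨
  c * length G           ∎)
  where
  open ≤-Reasoning
  G = sublistsOfLength L m
  bad = length G ∸ length (filter good? G)
  c = (y + t) C suc t
  B = (q C suc t) * ((length L ∸ suc t) C m)
  instance
    c≢0 : NonZero c
    -- `0 < y` gives `suc t ≤ y + t`, so `c` is positive and can be cancelled.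
    c≢0 = >-nonZero (0<nCk (+-monoˡ-≤ t 0<y))
  moment≤B : ∀ v → binomialMoment (P? v) L m (suc t) ≤ B
  moment≤B v = ≤-trans (binomialMoment-≤ (P? v) L m (suc t))
    (*-monoˡ-≤ ((length L ∸ suc t) C m) (C-mono (suc t) (deg≤q v)))
  swap : ∀ a b c → a * (b * c) ≡ b * (a * c)
  swap = solve-∀

-- The complete graph and complements of sublists

Touches : {n : ℕ} → Fin n → Fin n × Fin n → Set
Touches z p = proj₁ p ≡ z ⊎ proj₂ p ≡ z

touches? : {n : ℕ} (z : Fin n) → Decidable (Touches z)
touches? z p = (proj₁ p Fin.≟ z) ⊎-dec (proj₂ p Fin.≟ z)

module _ {A B : Set} {P : Pred A 0ℓ} {Q : Pred B 0ℓ} (P? : Decidable P) (Q? : Decidable Q) (f : A → B) where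
  filter-map : (∀ x → does (Q? (f x)) ≡ does (P? x)) → ∀ xs → filter Q? (map f xs) ≡ map f (filter P? xs)
  filter-map eq [] = refl
  filter-map eq (x ∷ xs) with does (Q? (f x)) | does (P? x) | eq x
  ... | true  | _ | refl = cong (f x ∷_) (filter-map eq xs)
  ... | false | _ | refl = filter-map eq xs

sucs : {n : ℕ} → Fin n × Fin n → Fin (suc n) × Fin (suc n)
sucs (i , j) = suc i , suc j

zeroTo : {n : ℕ} → Fin n → Fin (suc n) × Fin (suc n)
zeroTo j = zero , suc j

allPairs-suc : ∀ n → allPairs (suc n) ≡ map zeroTo (allFin n) ++ map sucs (allPairs n)
allPairs-suc n = begin
  allPairs (suc n)
    ≡⟨ cong (λ ys → filter lt? (cartesianProduct (zero ∷ ys) (zero ∷ ys))) (map-tabulate {n = n} id suc) ⟨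
  filter lt? (map (zero ,_) (map suc xs) ++ cartesianProduct (map suc xs) (zero ∷ map suc xs))
    ≡⟨ filter-++ lt? (map (zero ,_) (map suc xs)) _ ⟩
  filter lt? (map (zero ,_) (map suc xs)) ++ filter lt? (cartesianProduct (map suc xs) (zero ∷ map suc xs))
    ≡⟨ cong₂ _++_ (row-zero xs) (rows-suc xs xs) ⟩
  map zeroTo xs ++ map sucs (allPairs n) ∎
  where
  open ≡-Reasoning
  xs = allFin n
  lt? : ∀ {n} → Decidable (λ (p : Fin n × Fin n) → proj₁ p <ᶠ proj₂ p)
  lt? p = proj₁ p <ᶠ? proj₂ p
  row-zero : ∀ xs → filter lt? (map (zero {n} ,_) (map suc xs)) ≡ map zeroTo xs
  row-zero [] = refl
  row-zero (x ∷ xs) = cong (_ ∷_) (row-zero xs)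
  rows-suc : ∀ (xs ys : List (Fin n)) →
    filter lt? (cartesianProduct (map suc xs) (zero ∷ map suc ys)) ≡ map sucs (filter lt? (cartesianProduct xs ys))
  rows-suc [] ys = refl
  -- The pair `(suc x , zero)` is filtered out by computation. The rest of the row is
  -- `map sucs (map (x ,_) ys)`, since both ways of composing the maps give the same function.
  rows-suc (x ∷ xs) ys = begin
    filter lt? (map (suc x ,_) (map suc ys) ++ cartesianProduct (map suc xs) (zero ∷ map suc ys))
      ≡⟨ filter-++ lt? (map (suc x ,_) (map suc ys)) _ ⟩
    filter lt? (map (suc x ,_) (map suc ys)) ++ filter lt? (cartesianProduct (map suc xs) (zero ∷ map suc ys))
      ≡⟨ cong₂ (λ us vs → filter lt? us ++ vs) (trans (sym (map-∘ ys)) (map-∘ ys)) (rows-suc xs ys) ⟩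
    filter lt? (map sucs (map (x ,_) ys)) ++ map sucs (filter lt? (cartesianProduct xs ys))
      ≡⟨ cong (_++ map sucs (filter lt? (cartesianProduct xs ys))) (filter-map lt? lt? sucs (λ _ → refl) (map (x ,_) ys)) ⟩
    map sucs (filter lt? (map (x ,_) ys)) ++ map sucs (filter lt? (cartesianProduct xs ys))
      ≡⟨ map-++ sucs (filter lt? (map (x ,_) ys)) _ ⟨
    map sucs (filter lt? (map (x ,_) ys) ++ filter lt? (cartesianProduct xs ys))
      ≡⟨ cong (map sucs) (filter-++ lt? (map (x ,_) ys) _) ⟨
    map sucs (filter lt? (map (x ,_) ys ++ cartesianProduct xs ys)) ∎

length-allPairs : ∀ n → length (allPairs n) ≡ n C 2
length-allPairs zero = refl
length-allPairs (suc n) = begin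
  length (allPairs (suc n))                                  ≡⟨ cong length (allPairs-suc n) ⟩
  length (map zeroTo (allFin n) ++ map sucs (allPairs n))         ≡⟨ length-++ (map zeroTo (allFin n)) ⟩
  length (map zeroTo (allFin n)) + length (map sucs (allPairs n)) ≡⟨ cong₂ _+_ (length-map zeroTo (allFin n)) (length-map sucs (allPairs n)) ⟩
  length (allFin n) + length (allPairs n)                    ≡⟨ cong₂ _+_ (length-tabulate {n = n} id) (length-allPairs n) ⟩
  n + n C 2                                                  ≡⟨ cong (_+ n C 2) (nC1≡n n) ⟨
  n C 1 + n C 2                                              ≡⟨ nCk+nC[k+1]≡[n+1]C[k+1] n 1 ⟩
  suc n C 2                                                  ∎
  where open ≡-Reasoning

Unique-constant⇒length≤1 : {A : Set} {x : A} {xs : List A} → Unique xs → All (_≡ x) xs → length xs ≤ 1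
Unique-constant⇒length≤1 [] [] = z≤n
Unique-constant⇒length≤1 (_ ∷ []) (_ ∷ []) = s≤s z≤n
Unique-constant⇒length≤1 ((y≢z ∷ _) ∷ _) (refl ∷ refl ∷ _) = contradiction refl y≢z

count-touches-++ : ∀ {n} (v : Fin n) xs ys → count (touches? v) (xs ++ ys) ≡ count (touches? v) xs + count (touches? v) ys
count-touches-++ v xs ys = trans (cong length (filter-++ (touches? v) xs ys)) (length-++ (filter (touches? v) xs))

-- Split off the pairs at `zero`. They are the only ones touching `zero`; for `suc v`, at most one
-- of them, `zeroTo v`, adds to the degree of `v` in the smaller complete graph.
count-touches-allPairs : ∀ n (v : Fin (suc n)) → count (touches? v) (allPairs (suc n)) ≤ n
count-touches-allPairs n v = begin
  count (touches? v) (allPairs (suc n))                         ≡⟨ cong (count (touches? v)) (allPairs-suc n) ⟩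
  count (touches? v) (star n ++ rest n)                         ≡⟨ count-touches-++ v (star n) (rest n) ⟩
  count (touches? v) (star n) + count (touches? v) (rest n)     ≤⟨ split n v ⟩
  n ∎
  where
  open ≤-Reasoning
  star rest : ∀ n → Edges (suc n)
  star n = map zeroTo (allFin n)
  rest n = map sucs (allPairs n)
  untouched : ∀ {n} (p : Fin n × Fin n) → ¬ Touches zero (sucs p)
  untouched _ (inj₁ ())
  untouched _ (inj₂ ())
  at-suc : ∀ {n} (v : Fin n) {p} → p ∈ filter (touches? (suc v)) (star n) → p ≡ zeroTo v
  at-suc {n} v p∈ with ∈-filter⁻ (touches? (suc v)) {xs = star n} p∈
  ... | p∈star , t with ∈-map⁻ zeroTo p∈star
  at-suc v p∈ | p∈star , inj₁ () | _ , _ , refl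
  at-suc v p∈ | p∈star , inj₂ refl | _ , _ , refl = refl
  split : ∀ n (v : Fin (suc n)) → count (touches? v) (star n) + count (touches? v) (rest n) ≤ n
  split n zero = begin
    count (touches? zero) (star n) + count (touches? zero) (rest n)
      ≡⟨ cong (λ ys → count (touches? zero) (star n) + length ys)
           (filter-none (touches? zero) (All.map⁺ (All.universal untouched (allPairs n)))) ⟩
    count (touches? zero) (star n) + 0  ≡⟨ +-identityʳ _ ⟩
    count (touches? zero) (star n)      ≤⟨ length-filter (touches? zero) (star n) ⟩
    length (star n)                     ≡⟨ length-map zeroTo (allFin n) ⟩
    length (allFin n)                   ≡⟨ length-tabulate {n = n} id ⟩
    n ∎
  split (suc n) (suc v) = +-mono-≤
    (Unique-constant⇒length≤1
      (Unique.filter⁺ (touches? (suc v))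
        (Unique.map⁺ {f = zeroTo} (λ eq → Fin.suc-injective (cong proj₂ eq)) (Unique.allFin⁺ (suc n))))
      (All.tabulate (at-suc v)))
    (begin
      count (touches? (suc v)) (rest (suc n))
        ≡⟨ cong length (filter-map (touches? v) (touches? (suc v)) sucs (λ _ → refl) (allPairs (suc n))) ⟩
      length (map sucs (filter (touches? v) (allPairs (suc n))))
        ≡⟨ length-map sucs (filter (touches? v) (allPairs (suc n))) ⟩
      count (touches? v) (allPairs (suc n))
        ≤⟨ count-touches-allPairs n v ⟩
      n ∎)

∈-allPairs⁺ : ∀ {n} {i j : Fin n} → i <ᶠ j → (i , j) ∈ allPairs n
∈-allPairs⁺ {n} {i} {j} = ∈-filter⁺ (λ p → proj₁ p <ᶠ? proj₂ p) (∈-cartesianProduct⁺ (∈-allFin i) (∈-allFin j))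

∈-allPairs⁻ : ∀ {n} {p : Fin n × Fin n} → p ∈ allPairs n → proj₁ p <ᶠ proj₂ p
∈-allPairs⁻ {n} p∈ = proj₂ (∈-filter⁻ (λ p → proj₁ p <ᶠ? proj₂ p) {xs = cartesianProduct (allFin n) (allFin n)} p∈)

allPairs-unique : ∀ n → Unique (allPairs n)
allPairs-unique n = Unique.filter⁺ (λ p → proj₁ p <ᶠ? proj₂ p)
  (Unique.cartesianProduct⁺ (Unique.allFin⁺ n) (Unique.allFin⁺ n))

module _ {A : Set} where

  ∈-sublists⁻ : {E : List A} (L : List A) → E ∈ sublists L → E ⊆ L
  ∈-sublists⁻ [] (here refl) = []
  ∈-sublists⁻ (x ∷ L) E∈ with ∈-++⁻ (sublists L) E∈
  ... | inj₁ E∈L = x ∷ʳ ∈-sublists⁻ L E∈L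
  ... | inj₂ E∈map with ∈-map⁻ (x ∷_) E∈map
  ... | _ , E∈L , refl = refl ∷ ∈-sublists⁻ L E∈L

  -- Recursion on the sublist proof assigns each position of `L` to exactly one side, so lengths and
  -- counts add up by construction.
  complement : {E L : List A} → E ⊆ L → List A
  complement [] = []
  complement (y ∷ʳ τ) = y ∷ complement τ
  complement (_ ∷ τ) = complement τ

  complement-⊆ : {E L : List A} (τ : E ⊆ L) → complement τ ⊆ L
  complement-⊆ [] = []
  complement-⊆ (y ∷ʳ τ) = refl ∷ complement-⊆ τ
  complement-⊆ (_ ∷ τ) = _ ∷ʳ complement-⊆ τ

  ∈⊎∈-complement : {E L : List A} (τ : E ⊆ L) {x : A} → x ∈ L → x ∈ E ⊎ x ∈ complement τ
  ∈⊎∈-complement (y ∷ʳ τ) (here refl) = inj₂ (here refl)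
  ∈⊎∈-complement (y ∷ʳ τ) (there x∈L) = Sum.map₂ there (∈⊎∈-complement τ x∈L)
  ∈⊎∈-complement (refl ∷ τ) (here refl) = inj₁ (here refl)
  ∈⊎∈-complement (refl ∷ τ) (there x∈L) = Sum.map₁ there (∈⊎∈-complement τ x∈L)

  ∈-complement⇒∉ : {E L : List A} (τ : E ⊆ L) → Unique L → {x : A} → x ∈ complement τ → x ∉ E
  ∈-complement⇒∉ (y ∷ʳ τ) (y≢ ∷ _) (here refl) x∈E = All.lookup y≢ (lookup τ x∈E) refl
  ∈-complement⇒∉ (y ∷ʳ τ) (_ ∷ L!) (there x∈) x∈E = ∈-complement⇒∉ τ L! x∈ x∈E
  ∈-complement⇒∉ (refl ∷ τ) (y≢ ∷ _) x∈ (here refl) = All.lookup y≢ (lookup (complement-⊆ τ) x∈) refl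
  ∈-complement⇒∉ (refl ∷ τ) (_ ∷ L!) x∈ (there x∈E) = ∈-complement⇒∉ τ L! x∈ x∈E

  length-complement : {E L : List A} (τ : E ⊆ L) → length L ∸ length E ≡ length (complement τ)
  length-complement {E} τ = trans (cong (_∸ length E) (sym (+-length τ))) (m+n∸m≡n (length E) (length (complement τ)))
    where
    +-length : {E L : List A} (τ : E ⊆ L) → length E + length (complement τ) ≡ length L
    +-length [] = refl
    +-length {E} (y ∷ʳ τ) = trans (+-suc (length E) _) (cong suc (+-length τ))
    +-length (_ ∷ τ) = cong suc (+-length τ)

  -- This identifies the truncated differences in the moments with degrees in the complement graph.
  count-complement : {P : Pred A 0ℓ} (P? : Decidable P) {E L : List A} (τ : E ⊆ L) →
    count P? L ∸ count P? E ≡ count P? (complement τ)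
  count-complement P? {E} τ = trans (cong (_∸ count P? E) (sym (+-count τ))) (m+n∸m≡n (count P? E) (count P? (complement τ)))
    where
    +-count : {E L : List A} (τ : E ⊆ L) → count P? E + count P? (complement τ) ≡ count P? L
    +-count [] = refl
    +-count {E} (y ∷ʳ τ) with does (P? y)
    ... | true = trans (+-suc (count P? E) _) (cong suc (+-count τ))
    ... | false = +-count τ
    +-count {x ∷ E} (refl ∷ τ) with does (P? x)
    ... | true = cong suc (+-count τ)
    ... | false = +-count τ

-- Legal systems from matchings in the complement

Disjoint : {n : ℕ} → Fin n × Fin n → Fin n × Fin n → Set
Disjoint p q = ∀ {z} → Touches z p → ¬ Touches z q

subset : {n : ℕ} {P : Pred (Fin n) 0ℓ} → Decidable P → Subset n
subset P? = Vec.tabulate (does ∘ P?)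

lookup-subset : {n : ℕ} {P : Pred (Fin n) 0ℓ} (P? : Decidable P) (i : Fin n) →
  Vec.lookup (subset P?) i ≡ does (P? i)
lookup-subset P? = Vec.lookup∘tabulate (does ∘ P?)

∈-subset⁺ : {n : ℕ} {P : Pred (Fin n) 0ℓ} (P? : Decidable P) {i : Fin n} → P i → i ∈ˢ subset P?
∈-subset⁺ P? {i} pi = Vec.lookup⇒[]= i _ (trans (lookup-subset P? i) (dec-true (P? i) pi))

∈-subset⁻ : {n : ℕ} {P : Pred (Fin n) 0ℓ} (P? : Decidable P) {i : Fin n} → i ∈ˢ subset P? → P i
∈-subset⁻ P? {i} i∈ with P? i | trans (sym (lookup-subset P? i)) (Vec.[]=⇒lookup i∈)
... | yes pi | _ = pi

length≤1⇒≡ : {A : Set} {xs : List A} {x y : A} → length xs ≤ 1 → x ∈ xs → y ∈ xs → x ≡ y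
length≤1⇒≡ _ (here refl) (here refl) = refl
length≤1⇒≡ {xs = _ ∷ []} _ (there ()) _
length≤1⇒≡ {xs = _ ∷ []} _ _ (there ())
length≤1⇒≡ {xs = _ ∷ _ ∷ _} (s≤s ()) _ _

count-¬ : {A : Set} {P : Pred A 0ℓ} (P? : Decidable P) (xs : List A) →
  count P? xs + length (filter (¬? ∘ P?) xs) ≡ length xs
count-¬ P? [] = refl
count-¬ P? (x ∷ xs) with does (P? x)
... | true = cong suc (count-¬ P? xs)
... | false = trans (+-suc (count P? xs) _) (cong suc (count-¬ P? xs))

count-filter-≤ : {A : Set} {P Q : Pred A 0ℓ} (P? : Decidable P) (Q? : Decidable Q) (xs : List A) →
  count P? (filter Q? xs) ≤ count P? xs
count-filter-≤ P? Q? [] = z≤n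
count-filter-≤ P? Q? (x ∷ xs) with does (Q? x)
... | true with does (P? x)
...   | true = s≤s (count-filter-≤ P? Q? xs)
...   | false = count-filter-≤ P? Q? xs
count-filter-≤ P? Q? (x ∷ xs) | false with does (P? x)
...   | true = m≤n⇒m≤1+n (count-filter-≤ P? Q? xs)
...   | false = count-filter-≤ P? Q? xs

-- Greedy matchings and neighbourhoods

module _ {n : ℕ} where

  -- Taking an edge and deleting all edges at its two ends costs at most `Δ + Δ` edges. After `k`
  -- rounds an edge is still left, which gives the extra one.
  greedyMatching : ∀ Δ k (F : Edges n) → (∀ z → count (touches? z) F ≤ Δ) → k * (Δ + Δ) < length F →
    ∃[ ps ] length ps ≡ suc k × All (_∈ F) ps × AllPairs Disjoint ps
  greedyMatching Δ k [] deg≤Δ ()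
  greedyMatching Δ zero (p ∷ F) deg≤Δ _ = p ∷ [] , refl , here refl ∷ [] , [] ∷ []
  greedyMatching Δ (suc k) F@((a , b) ∷ _) deg≤Δ many =
    (a , b) ∷ ps , cong suc len , here refl ∷ All.map F″⊆F ps⊆F″ , All.map disjoint ps⊆F″ ∷ ps-disjoint
    where
    awayFrom : Fin n → Edges n → Edges n
    awayFrom z = filter (¬? ∘ touches? z)
    F″ = awayFrom b (awayFrom a F)
    awayFrom-length : ∀ z G → count (touches? z) G ≤ Δ → length G ≤ Δ + length (awayFrom z G)
    awayFrom-length z G d≤Δ = ≤-trans (≤-reflexive (sym (count-¬ (touches? z) G))) (+-monoˡ-≤ _ d≤Δ)
    deg′≤Δ : ∀ z → count (touches? z) (awayFrom a F) ≤ Δ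
    deg′≤Δ z = ≤-trans (count-filter-≤ (touches? z) (¬? ∘ touches? a) F) (deg≤Δ z)
    remaining : k * (Δ + Δ) < length F″
    remaining = +-cancelˡ-< (Δ + Δ) _ _ (begin-strict
      Δ + Δ + k * (Δ + Δ)              <⟨ many ⟩
      length F                         ≤⟨ awayFrom-length a F (deg≤Δ a) ⟩
      Δ + length (awayFrom a F)        ≤⟨ +-monoʳ-≤ Δ (awayFrom-length b (awayFrom a F) (deg′≤Δ b)) ⟩
      Δ + (Δ + length F″)              ≡⟨ +-assoc Δ Δ _ ⟨
      Δ + Δ + length F″                ∎)
      where open ≤-Reasoning
    rec = greedyMatching Δ k F″
      (λ z → ≤-trans (count-filter-≤ (touches? z) (¬? ∘ touches? b) (awayFrom a F)) (deg′≤Δ z)) remaining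
    ps = proj₁ rec
    len = proj₁ (proj₂ rec)
    ps⊆F″ = proj₁ (proj₂ (proj₂ rec))
    ps-disjoint = proj₂ (proj₂ (proj₂ rec))
    F″⊆F : ∀ {q} → q ∈ F″ → q ∈ F
    F″⊆F q∈ = proj₁ (∈-filter⁻ (¬? ∘ touches? a) (proj₁ (∈-filter⁻ (¬? ∘ touches? b) q∈)))
    disjoint : ∀ {q} → q ∈ F″ → Disjoint (a , b) q
    disjoint q∈ (inj₂ refl) = proj₂ (∈-filter⁻ (¬? ∘ touches? b) {xs = awayFrom a F} q∈)
    disjoint q∈ (inj₁ refl) = proj₂ (∈-filter⁻ (¬? ∘ touches? a) {xs = F} (proj₁ (∈-filter⁻ (¬? ∘ touches? b) q∈)))

  -- At most one edge is lost: when one edge touches `z`, disjointness keeps all others away from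
  -- it.
  filter-away-disjoint : ∀ z {ps : Edges n} → AllPairs Disjoint ps → length ps ≤ suc (length (filter (¬? ∘ touches? z) ps))
  filter-away-disjoint z [] = z≤n
  filter-away-disjoint z {p ∷ ps} (d ∷ ds) with touches? z p
  ... | yes tp = s≤s (≤-reflexive (cong length (sym (begin
    filter away? (p ∷ ps)   ≡⟨ filter-reject away? (λ ¬tp → ¬tp tp) ⟩
    filter away? ps         ≡⟨ filter-all away? (All.map (λ dq → dq tp) d) ⟩
    ps                      ∎))))
    where
    open ≡-Reasoning
    away? = ¬? ∘ touches? z
  ... | no ¬tp = s≤s (≤-trans (filter-away-disjoint z ds)
    (≤-reflexive (cong length (sym (filter-accept (¬? ∘ touches? z) ¬tp)))))

  -- Pigeonhole: each vertex of `K` rules out at most one of the disjoint edges.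
  avoid : ∀ (K : List (Fin n)) {ps : Edges n} → AllPairs Disjoint ps → length K < length ps →
    ∃[ p ] p ∈ ps × (∀ {z} → z ∈ K → ¬ Touches z p)
  avoid [] {p ∷ ps} _ _ = p , here refl , λ ()
  avoid (z ∷ K) {ps} ds K<ps
    with p , p∈ , away ← avoid K (AllPairs.filter⁺ (¬? ∘ touches? z) ds) (s≤s⁻¹ (≤-trans K<ps (filter-away-disjoint z ds)))
    with p∈ps , ¬tz ← ∈-filter⁻ (¬? ∘ touches? z) {xs = ps} p∈
    = p , p∈ps , λ { (here refl) → ¬tz ; (there z∈K) → away z∈K }

  -- Applied only to edges at `u`, so in the last case `u` is the second end.
  otherEnd : Fin n → Fin n × Fin n → Fin n
  otherEnd u (a , b) with a Fin.≟ u
  ... | yes _ = b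
  ... | no _ = a

  neighbours : Edges n → Fin n → List (Fin n)
  neighbours F u = map (otherEnd u) (filter (touches? u) F)

  Adj⇒∈-neighbours : ∀ {F u w} → Adj F u w → w ∈ neighbours F u
  Adj⇒∈-neighbours {F} {u} {w} (inj₁ uw∈F) = subst (_∈ neighbours F u) otherEnd-uw
    (∈-map⁺ (otherEnd u) (∈-filter⁺ (touches? u) uw∈F (inj₁ refl)))
    where
    otherEnd-uw : otherEnd u (u , w) ≡ w
    otherEnd-uw with u Fin.≟ u
    ... | yes _ = refl
    ... | no u≢u = contradiction refl u≢u
  Adj⇒∈-neighbours {F} {u} {w} (inj₂ wu∈F) = subst (_∈ neighbours F u) otherEnd-wu
    (∈-map⁺ (otherEnd u) (∈-filter⁺ (touches? u) wu∈F (inj₂ refl)))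
    where
    otherEnd-wu : otherEnd u (w , u) ≡ w
    otherEnd-wu with w Fin.≟ u
    ... | yes w≡u = sym w≡u
    ... | no _ = refl

-- The legal system of a matching

module _ {n : ℕ} {E F : Edges n}
  (complete : ∀ {i j} → i <ᶠ j → (i , j) ∈ E ⊎ (i , j) ∈ F)
  (F∩E≡∅ : ∀ {p} → p ∈ F → p ∉ E)
  (E-ordered : ∀ {p} → p ∈ E → proj₁ p <ᶠ proj₂ p)
  (F-ordered : ∀ {p} → p ∈ F → proj₁ p <ᶠ proj₂ p)
  where

  Adj-total : ∀ {u v} → u ≢ v → Adj E u v ⊎ Adj F u v
  Adj-total {u} {v} u≢v with Fin.<-cmp u v
  ... | tri< u<v _ _ = Sum.map inj₁ inj₁ (complete u<v)
  ... | tri≈ _ u≡v _ = contradiction u≡v u≢v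
  ... | tri> _ _ v<u = Sum.map inj₂ inj₂ (complete v<u)

  ¬Adj-refl : ∀ {u} → ¬ Adj E u u
  ¬Adj-refl (inj₁ uu∈E) = Fin.<-irrefl refl (E-ordered uu∈E)
  ¬Adj-refl (inj₂ uu∈E) = Fin.<-irrefl refl (E-ordered uu∈E)

  ∈F⇒¬Adj : ∀ {a b} → (a , b) ∈ F → ¬ Adj E a b
  ∈F⇒¬Adj ab∈F (inj₁ ab∈E) = F∩E≡∅ ab∈F ab∈E
  ∈F⇒¬Adj ab∈F (inj₂ ba∈E) = Fin.<-asym (F-ordered ab∈F) (E-ordered ba∈E)

  -- Guarantees that a transversal containing `u` joins `u` to its own end of `p`, whichever end
  -- that is.
  Link : Fin n → Fin n × Fin n → Set
  Link u p = Touches u p ⊎ Adj E u (proj₁ p) × Adj E u (proj₂ p)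

  module Matching (ps : Edges n) (ps⊆F : All (_∈ F) ps) (ps-disjoint : AllPairs Disjoint ps) where

    touching-unique : ∀ {z p q} → p ∈ ps → q ∈ ps → Touches z p → Touches z q → p ≡ q
    touching-unique = go ps-disjoint
      where
      go : ∀ {ps} → AllPairs Disjoint ps → ∀ {z p q} → p ∈ ps → q ∈ ps → Touches z p → Touches z q → p ≡ q
      go (_ ∷ _) (here refl) (here refl) _ _ = refl
      go (d ∷ _) (here refl) (there q∈) tp tq = contradiction tq (All.lookup d q∈ tp)
      go (d ∷ _) (there p∈) (here refl) tp tq = contradiction tp (All.lookup d p∈ tq)
      go (_ ∷ ds) (there p∈) (there q∈) tp tq = go ds p∈ q∈ tp tq

    -- One formula for both kinds of move: the matching edge at `v`, or `{v}` when `v` is unmatched.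
    Together : Fin n → Fin n → Set
    Together v w = w ≡ v ⊎ Any (λ p → Touches v p × Touches w p) ps

    together? : ∀ v → Decidable (Together v)
    together? v w = (w Fin.≟ v) ⊎-dec any? (λ p → touches? v p ×-dec touches? w p) ps

    IsFirst : Fin n → Set
    IsFirst w = Any (λ p → proj₁ p ≡ w) ps

    isFirst? : Decidable IsFirst
    isFirst? w = any? (λ p → proj₁ p Fin.≟ w) ps

    moves : Fin n → Subset n
    moves v = subset (together? v)

    start : Subset n
    start = subset isFirst?

    moves-isMoves : IsMoves E moves
    moves-isMoves v = ∈-subset⁺ (together? v) (inj₁ refl) , λ w v~w w∈ → nonadjacent v~w (∈-subset⁻ (together? v) w∈)
      where
      nonadjacent : ∀ {w} → Adj E v w → ¬ Together v w
      nonadjacent v~w (inj₁ refl) = ¬Adj-refl v~w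
      nonadjacent v~w (inj₂ same) with find same
      ... | p , p∈ , inj₁ refl , inj₁ refl = ¬Adj-refl v~w
      ... | p , p∈ , inj₁ refl , inj₂ refl = ∈F⇒¬Adj (All.lookup ps⊆F p∈) v~w
      ... | p , p∈ , inj₂ refl , inj₁ refl = ∈F⇒¬Adj (All.lookup ps⊆F p∈) (Sum.swap v~w)
      ... | p , p∈ , inj₂ refl , inj₂ refl = ¬Adj-refl v~w

    -- A matching edge shared by `v` and `a` must be `p`, the only one at `a`, and so contains `b`
    -- as well.
    together-transfer : ∀ {v a b p} → p ∈ ps → Touches a p → Touches b p → Together v a → Together v b
    together-transfer p∈ ta tb (inj₁ refl) = inj₂ (Any.map (λ { refl → ta , tb }) p∈)
    together-transfer p∈ ta tb (inj₂ same) with q , q∈ , tv , ta′ ← find same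
      with refl ← touching-unique p∈ q∈ ta ta′ = inj₂ (Any.map (λ { refl → tv , tb }) p∈)

    -- By `together-transfer` every generator takes equal values at the two ends, and pointwise
    -- `xor` preserves this.
    span-balanced : ∀ {g a b} → InSpan moves g → (a , b) ∈ ps → Vec.lookup g a ≡ Vec.lookup g b
    span-balanced {a = a} {b} zero _ = trans (Vec.lookup-replicate a false) (sym (Vec.lookup-replicate b false))
    span-balanced {a = a} {b} (add v {g} g∈) ab∈ = begin
      Vec.lookup (moves v △ g) a                   ≡⟨ Vec.lookup-zipWith _xor_ a (moves v) g ⟩
      Vec.lookup (moves v) a xor Vec.lookup g a    ≡⟨ cong₂ _xor_ move-balanced (span-balanced g∈ ab∈) ⟩
      Vec.lookup (moves v) b xor Vec.lookup g b    ≡⟨ Vec.lookup-zipWith _xor_ b (moves v) g ⟨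
      Vec.lookup (moves v △ g) b                   ∎
      where
      open ≡-Reasoning
      move-balanced : Vec.lookup (moves v) a ≡ Vec.lookup (moves v) b
      move-balanced = begin
        Vec.lookup (moves v) a   ≡⟨ lookup-subset (together? v) a ⟩
        does (together? v a)     ≡⟨ does-⇔ (mk⇔ (together-transfer ab∈ (inj₁ refl) (inj₂ refl))
                                                (together-transfer ab∈ (inj₂ refl) (inj₁ refl)))
                                      (together? v a) (together? v b) ⟩
        does (together? v b)     ≡⟨ lookup-subset (together? v) b ⟨
        Vec.lookup (moves v) b   ∎

    Transversal : Subset n → Set
    Transversal X = ∀ {a b} → (a , b) ∈ ps → Vec.lookup X a ≡ not (Vec.lookup X b)

    start-transversal : Transversal start
    start-transversal {a} {b} ab∈ = begin
      Vec.lookup start a         ≡⟨ lookup-subset isFirst? a ⟩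
      does (isFirst? a)          ≡⟨ dec-true (isFirst? a) (Any.map (λ { refl → refl }) ab∈) ⟩
      not false                  ≡⟨ cong not (dec-false (isFirst? b) b-notFirst) ⟨
      not (does (isFirst? b))    ≡⟨ cong not (lookup-subset isFirst? b) ⟨
      not (Vec.lookup start b)   ∎
      where
      open ≡-Reasoning
      -- A matching edge starting at `b` shares `b` with `(a , b)`, so it equals `(a , b)` and
      -- forces `a ≡ b`, against `F-ordered`.
      b-notFirst : ¬ IsFirst b
      b-notFirst first with q , q∈ , refl ← find first
        with refl ← touching-unique ab∈ q∈ (inj₂ refl) (inj₁ refl) = Fin.<-irrefl refl (F-ordered (All.lookup ps⊆F ab∈))

    △-transversal : ∀ {g} → InSpan moves g → Transversal (g △ start)
    △-transversal {g} g∈ {a} {b} ab∈ = begin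
      Vec.lookup (g △ start) a                         ≡⟨ Vec.lookup-zipWith _xor_ a g start ⟩
      Vec.lookup g a xor Vec.lookup start a            ≡⟨ cong₂ _xor_ (span-balanced g∈ ab∈) (start-transversal ab∈) ⟩
      Vec.lookup g b xor not (Vec.lookup start b)      ≡⟨ xor-not (Vec.lookup g b) _ ⟩
      not (Vec.lookup g b xor Vec.lookup start b)      ≡⟨ cong not (Vec.lookup-zipWith _xor_ b g start) ⟨
      not (Vec.lookup (g △ start) b)                   ∎
      where
      open ≡-Reasoning
      xor-not : ∀ x y → x xor not y ≡ not (x xor y)
      xor-not false y = refl
      xor-not true y = refl

    ∁-transversal : ∀ {X} → Transversal X → Transversal (∁ X)
    ∁-transversal {X} tr {a} {b} ab∈ = begin
      Vec.lookup (∁ X) a           ≡⟨ Vec.lookup-map a not X ⟩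
      not (Vec.lookup X a)         ≡⟨ cong not (tr ab∈) ⟩
      not (not (Vec.lookup X b))   ≡⟨ cong not (Vec.lookup-map b not X) ⟨
      not (Vec.lookup (∁ X) b)     ∎
      where open ≡-Reasoning

    -- The witness is the end of `p` lying in `X`. A member of `X` on `p` must be that end, as the
    -- other lies outside `X`; any other linked vertex is adjacent to both ends.
    transversal-meets : ∀ {X} → Transversal X → ∀ {p} → p ∈ ps →
      ∃[ c ] c ∈ˢ X × (∀ {u} → u ∈ˢ X → Link u p → u ≡ c ⊎ Adj E u c)
    transversal-meets {X} tr {a , b} ab∈ with Vec.lookup X b in Xb | tr ab∈
    ... | true | Xa = b , Vec.lookup⇒[]= b X Xb , λ where
      u∈X (inj₁ (inj₁ refl)) → contradiction (trans (sym (Vec.[]=⇒lookup u∈X)) Xa) (λ ())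
      u∈X (inj₁ (inj₂ refl)) → inj₁ refl
      u∈X (inj₂ (_ , u~b)) → inj₂ u~b
    ... | false | Xa = a , Vec.lookup⇒[]= a X Xa , λ where
      u∈X (inj₁ (inj₁ refl)) → inj₁ refl
      u∈X (inj₁ (inj₂ refl)) → contradiction (trans (sym (Vec.[]=⇒lookup u∈X)) Xb) (λ ())
      u∈X (inj₂ (u~a , _)) → inj₂ u~a

    module _ (linked : ∀ u v → ∃[ p ] p ∈ ps × Link u p × Link v p) (root : Fin n) where

      -- Both vertices equal or neighbour the same end `c` of their common edge, so a walk through
      -- `c` stays in `X`. The vertex `root` serves to obtain some matching edge, hence a member of
      -- `X`.
      transversal-connected : ∀ {X} → Transversal X → ConnectedNonempty E X
      transversal-connected {X} tr = nonempty , walk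
        where
        nonempty : ∃[ c ] c ∈ˢ X
        nonempty with _ , p∈ , _ ← linked root root with c , c∈X , _ ← transversal-meets tr p∈ = c , c∈X
        walk : ∀ u v → u ∈ˢ X → v ∈ˢ X → WalkIn E X u v
        walk u v u∈X v∈X with p , p∈ , lu , lv ← linked u v with transversal-meets tr p∈
        ... | c , c∈X , near with near u∈X lu | near v∈X lv
        ... | inj₁ refl | inj₁ refl = here u∈X
        ... | inj₁ refl | inj₂ v~c = step u∈X (Sum.swap v~c) (here v∈X)
        ... | inj₂ u~c | inj₁ refl = step u∈X u~c (here v∈X)
        ... | inj₂ u~c | inj₂ v~c = step u∈X u~c (step c∈X (Sum.swap v~c) (here v∈X))

      matching⇒legalSystem : HasLegalSystem E
      matching⇒legalSystem = start , moves , moves-isMoves , λ g g∈ →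
        transversal-connected (△-transversal g∈) ,
        transversal-connected (∁-transversal {g △ start} (△-transversal g∈))

  -- An `F`-edge from `u` to an end of `p` is `p` itself by the degree bound. So a vertex off `p` is
  -- `E`-adjacent to both ends, and all vertices are linked to `p`.
  isolatedEdge⇒legalSystem : (∀ z → count (touches? z) F ≤ 1) → ∀ {p} → p ∈ F → HasLegalSystem E
  isolatedEdge⇒legalSystem deg≤1 {p} p∈F =
    Matching.matching⇒legalSystem (p ∷ []) (p∈F ∷ []) ([] ∷ []) (λ u v → p , here refl , link u , link v) (proj₁ p)
    where
    adjacent : ∀ {u w} → ¬ Touches u p → Touches w p → Adj E u w
    adjacent {u} {w} ¬tu tw with Adj-total {u} {w} (λ { refl → ¬tu tw })
    ... | inj₁ u~w = u~w
    ... | inj₂ (inj₁ uw∈F) = contradiction (subst (Touches u)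
            (length≤1⇒≡ (deg≤1 w) (∈-filter⁺ (touches? w) uw∈F (inj₂ refl)) (∈-filter⁺ (touches? w) p∈F tw)) (inj₁ refl)) ¬tu
    ... | inj₂ (inj₂ wu∈F) = contradiction (subst (Touches u)
            (length≤1⇒≡ (deg≤1 w) (∈-filter⁺ (touches? w) wu∈F (inj₁ refl)) (∈-filter⁺ (touches? w) p∈F tw)) (inj₂ refl)) ¬tu
    link : ∀ u → Link u p
    link u with touches? u p
    ... | yes tu = inj₁ tu
    ... | no ¬tu = inj₂ (adjacent ¬tu (inj₁ refl) , adjacent ¬tu (inj₂ refl))

  boundedDegree⇒legalSystem : ∀ Δ → (∀ z → count (touches? z) F ≤ Δ) → 4 * (Δ * suc Δ) < length F → HasLegalSystem E
  boundedDegree⇒legalSystem Δ deg≤Δ many =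
    -- `2 + (Δ + Δ)` bounds the length of the list `K` below; the matching has one edge more.
    fromMatching (greedyMatching Δ (2 + (Δ + Δ)) F deg≤Δ (subst (_< length F) (expand Δ) many))
    where
    expand : ∀ Δ → 4 * (Δ * suc Δ) ≡ (2 + (Δ + Δ)) * (Δ + Δ)
    expand = solve-∀
    fromMatching : ∃[ ps ] length ps ≡ suc (2 + (Δ + Δ)) × All (_∈ F) ps × AllPairs Disjoint ps → HasLegalSystem E
    fromMatching ([] , () , _)
    fromMatching (ps@((r , _) ∷ _) , len , ps⊆F , ds) =
      Matching.matching⇒legalSystem ps ps⊆F ds linked r
      where
      linked : ∀ u v → ∃[ p ] p ∈ ps × Link u p × Link v p
      linked u v = p , p∈ ,
          inj₂ (adjacent (here refl) ∈u (inj₁ refl) , adjacent (here refl) ∈u (inj₂ refl)) ,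
          inj₂ (adjacent (there (here refl)) ∈v (inj₁ refl) , adjacent (there (here refl)) ∈v (inj₂ refl))
        where
        K = u ∷ v ∷ neighbours F u ++ neighbours F v
        few : length K < length ps
        few = begin-strict
          2 + length (neighbours F u ++ neighbours F v)            ≡⟨ cong (2 +_) (length-++ (neighbours F u)) ⟩
          2 + (length (neighbours F u) + length (neighbours F v))  ≤⟨ +-monoʳ-≤ 2 (+-mono-≤ (len≤ u) (len≤ v)) ⟩
          2 + (Δ + Δ)                                              <⟨ ≤-reflexive (sym len) ⟩
          length ps                                                ∎
          where
          open ≤-Reasoning
          len≤ : ∀ z → length (neighbours F z) ≤ Δ
          len≤ z = ≤-trans (≤-reflexive (length-map (otherEnd z) (filter (touches? z) F))) (deg≤Δ z)
        found = avoid K ds few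
        p = proj₁ found
        p∈ = proj₁ (proj₂ found)
        away : ∀ {z} → z ∈ K → ¬ Touches z p
        away = proj₂ (proj₂ found)
        ∈u : ∀ {w} → w ∈ neighbours F u → w ∈ K
        ∈u w∈ = there (there (∈-++⁺ˡ w∈))
        ∈v : ∀ {w} → w ∈ neighbours F v → w ∈ K
        ∈v w∈ = there (there (∈-++⁺ʳ (neighbours F u) w∈))
        -- An end `w` of `p` avoids `K`, so it is neither `z` nor an `F`-neighbour of `z`.
        adjacent : ∀ {z w} → z ∈ K → (∀ {x} → x ∈ neighbours F z → x ∈ K) → Touches w p → Adj E z w
        adjacent {z} {w} z∈K nb⊆K tw with Adj-total {z} {w} (λ { refl → away z∈K tw })
        ... | inj₁ z~w = z~w
        ... | inj₂ z≁w = contradiction tw (away (nb⊆K (Adj⇒∈-neighbours z≁w)))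

-- Random graphs

-- The degree of v in the complement of E.
codegree : {n : ℕ} → Edges n → Fin n → ℕ
codegree {n} E v = count (touches? v) (allPairs n) ∸ count (touches? v) E

module _ {n m : ℕ} {E : Edges n} (E∈ : E ∈ graphsWith n m) where

  private
    E∈sublists : E ∈ sublists (allPairs n)
    E∈sublists = proj₁ (∈-filter⁻ (λ E → length E ≟ m) E∈)
    τ : E ⊆ allPairs n
    τ = ∈-sublists⁻ (allPairs n) E∈sublists
    F : Edges n
    F = complement τ
    length-F : length F ≡ n C 2 ∸ m
    length-F = begin
      length F                            ≡⟨ length-complement τ ⟨
      length (allPairs n) ∸ length E      ≡⟨ cong₂ _∸_ (length-allPairs n)
                                               (proj₂ (∈-filter⁻ (λ E → length E ≟ m) {xs = sublists (allPairs n)} E∈)) ⟩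
      n C 2 ∸ m                           ∎
      where open ≡-Reasoning

    codegree≤⇒deg≤ : ∀ {Δ} → (∀ v → codegree E v < suc Δ) → ∀ v → count (touches? v) F ≤ Δ
    codegree≤⇒deg≤ small v = subst (_≤ _) (count-complement (touches? v) τ) (s≤s⁻¹ (small v))

  -- `m < n C 2` makes the complement nonempty; its first edge serves as the isolated edge.
  codegree<2⇒legalSystem : m < n C 2 → (∀ v → codegree E v < 2) → HasLegalSystem E
  codegree<2⇒legalSystem m<N small = fromEdges F refl
    where
    fromEdges : ∀ F′ → F ≡ F′ → HasLegalSystem E
    fromEdges [] F≡[] = contradiction (trans (sym length-F) (cong length F≡[])) (m>n⇒m∸n≢0 m<N)
    fromEdges (p ∷ _) F≡ = isolatedEdge⇒legalSystem
      (∈⊎∈-complement τ ∘ ∈-allPairs⁺) (∈-complement⇒∉ τ (allPairs-unique n))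
      (∈-allPairs⁻ ∘ lookup τ) (∈-allPairs⁻ ∘ lookup (complement-⊆ τ))
      (codegree≤⇒deg≤ small) {p} (subst (p ∈_) (sym F≡) (here refl))

  codegree≤⇒legalSystem : ∀ Δ → 4 * (Δ * suc Δ) < n C 2 ∸ m → (∀ v → codegree E v < suc Δ) → HasLegalSystem E
  codegree≤⇒legalSystem Δ many small = boundedDegree⇒legalSystem
    (∈⊎∈-complement τ ∘ ∈-allPairs⁺) (∈-complement⇒∉ τ (allPairs-unique n))
    (∈-allPairs⁻ ∘ lookup τ) (∈-allPairs⁻ ∘ lookup (complement-⊆ τ))
    Δ (codegree≤⇒deg≤ small) (subst (4 * (Δ * suc Δ) <_) (sym length-F) many)

2*nC2 : ∀ n → 2 * (n C 2) ≡ (n ∸ 1) * n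
2*nC2 n = trans (C-sucʳ n 1) (cong ((n ∸ 1) *_) (nC1≡n n))

-- Failure probability at most 1/k, stated without division.
MostlyLegal : ℕ → ℕ → ℕ → Set
MostlyLegal n m k = ∃[ Good ] (Good ⊆ graphsWith n m) × All HasLegalSystem Good ×
  (k * (length (graphsWith n m) ∸ length Good) ≤ length (graphsWith n m))

-- The mean codegree is 2e/n with e = N - m, so the sparsity hypothesis puts `y` at least a factor
-- `r` above it. `Good` is cut out by the decidable codegree bound, which implies legality.
fewLargeCodegrees⇒mostlyLegal : ∀ n m r y t k → 0 < n → 0 < y → 2 * r * (n C 2 ∸ m) ≤ y * n → k * n ≤ r ^ suc t →
  (∀ {E} (E∈ : E ∈ graphsWith n m) → (∀ v → codegree E v < y + t) → HasLegalSystem E) →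
  MostlyLegal n m k
fewLargeCodegrees⇒mostlyLegal n@(suc q) m r y t k _ 0<y sparse kn≤r legal =
  filter good? (graphsWith n m) , filter-⊆ good? (graphsWith n m) ,
  All.tabulate (λ E∈ → let E∈G , good = ∈-filter⁻ good? {xs = graphsWith n m} E∈ in legal E∈G good) ,
  few-with-large-deficit touches? (allPairs n) m r q y t k (count-touches-allPairs q) q≤N 0<y sparse′ kn≤r good?
  where
  open ≤-Reasoning
  good? : Decidable (λ E → ∀ v → codegree E v < y + t)
  good? E = Fin.all? (λ v → codegree E v <? y + t)
  q≤N : q ≤ length (allPairs n)
  q≤N = begin
    q                    ≡⟨ nC1≡n q ⟨
    q C 1                ≤⟨ m≤m+n _ _ ⟩
    q C 1 + q C 2        ≡⟨ nCk+nC[k+1]≡[n+1]C[k+1] q 1 ⟩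
    n C 2                ≡⟨ length-allPairs n ⟨
    length (allPairs n)  ∎
  rearrange₁ : ∀ r q e → 2 * (r * q * e) ≡ q * (2 * r * e)
  rearrange₁ = solve-∀
  rearrange₂ : ∀ q y n → q * (y * n) ≡ y * (q * n)
  rearrange₂ = solve-∀
  rearrange₃ : ∀ y N → y * (2 * N) ≡ 2 * (y * N)
  rearrange₃ = solve-∀
  sparse′ : r * q * (length (allPairs n) ∸ m) ≤ y * length (allPairs n)
  sparse′ = subst (λ N → r * q * (N ∸ m) ≤ y * N) (sym (length-allPairs n)) (*-cancelˡ-≤ 2 (begin
    2 * (r * q * (n C 2 ∸ m))      ≡⟨ rearrange₁ r q (n C 2 ∸ m) ⟩
    q * (2 * r * (n C 2 ∸ m))      ≤⟨ *-monoʳ-≤ q sparse ⟩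
    q * (y * n)                    ≡⟨ rearrange₂ q y n ⟩
    y * (q * n)                    ≡⟨ cong (y *_) (2*nC2 n) ⟨
    y * (2 * (n C 2))              ≡⟨ rearrange₃ y (n C 2) ⟩
    2 * (y * (n C 2))              ∎))

-- Numerical estimates and the choice of parameters

bracket : (f : ℕ → ℕ) → f 0 ≡ 0 → (∀ i → f i < f (suc i)) → ∀ n → ∃[ b ] f b ≤ n × n < f (suc b)
bracket f f0 f< zero = 0 , ≤-reflexive f0 , ≤-<-trans z≤n (f< 0)
-- Raising `n` by one moves `b` by at most one, as `f` is strictly increasing.
bracket f f0 f< (suc n) with b , fb≤n , n<f ← bracket f f0 f< n | suc n <? f (suc b)
... | yes below = b , m≤n⇒m≤1+n fb≤n , below
... | no above = suc b , ≮⇒≥ above , ≤-<-trans n<f (f< (suc b))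

n<2^n : ∀ n → n < 2 ^ n
n<2^n zero = s≤s z≤n
n<2^n (suc n) = begin-strict
  suc n            ≤⟨ n<2^n n ⟩
  2 ^ n            <⟨ m<m+n (2 ^ n) (≤-<-trans z≤n (n<2^n n)) ⟩
  2 ^ n + 2 ^ n    ≡⟨ cong (2 ^ n +_) (+-identityʳ (2 ^ n)) ⟨
  2 ^ suc n        ∎
  where open ≤-Reasoning

square-cancel-≤ : ∀ {a b} → a * a ≤ b * b → a ≤ b
square-cancel-≤ a²≤b² = ≮⇒≥ (λ b<a → <⇒≱ (*-mono-< b<a b<a) a²≤b²)

-- Multiplying 100 e ≤ n² by e ≤ 6 y² gives e² ≤ 0.06 (yn)², and 16 × 0.06 < 1.
4e≤yn : ∀ {x y n e} → 10 ≤ x → 9 * x ≤ 10 * y → e ≤ 4 * (x * suc x) → 100 * e ≤ n * n → 4 * e ≤ y * n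
4e≤yn {x} {y} {n} {e} 10≤x 9x≤10y e≤ 100e≤ = square-cancel-≤ (*-cancelˡ-≤ 6 (begin
  6 * (4 * e * (4 * e))       ≡⟨ rearrange₁ e ⟩
  96 * (e * e)                ≤⟨ *-monoˡ-≤ (e * e) (m≤m+n 96 4) ⟩
  100 * (e * e)               ≡⟨ *-assoc 100 e e ⟨
  100 * e * e                 ≤⟨ *-mono-≤ 100e≤ e≤6yy ⟩
  n * n * (6 * (y * y))       ≡⟨ rearrange₂ n y ⟩
  6 * (y * n * (y * n))       ∎))
  where
  open ≤-Reasoning
  rearrange₁ : ∀ e → 6 * (4 * e * (4 * e)) ≡ 96 * (e * e)
  rearrange₁ = solve-∀
  rearrange₂ : ∀ n y → n * n * (6 * (y * y)) ≡ 6 * (y * n * (y * n))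
  rearrange₂ = solve-∀
  rearrange₃ : ∀ x → 10 * (4 * (x * suc x)) ≡ 40 * (x * x) + 4 * (10 * x)
  rearrange₃ = solve-∀
  rearrange₄ : ∀ x → 81 * (40 * (x * x) + 4 * (x * x)) ≡ 44 * (9 * x * (9 * x))
  rearrange₄ = solve-∀
  rearrange₅ : ∀ y → 44 * (10 * y * (10 * y)) + 460 * (y * y) ≡ 810 * (6 * (y * y))
  rearrange₅ = solve-∀
  -- With `10 ≤ x`, 4x(x+1) ≤ 4.4 x²; with x ≤ 10y/9 this is at most (440/81) y², and 440/81 < 6.
  e≤6yy : e ≤ 6 * (y * y)
  e≤6yy = *-cancelˡ-≤ 810 (begin
    810 * e                                  ≡⟨ *-assoc 81 10 e ⟩
    81 * (10 * e)                            ≤⟨ *-monoʳ-≤ 81 (*-monoʳ-≤ 10 e≤) ⟩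
    81 * (10 * (4 * (x * suc x)))            ≡⟨ cong (81 *_) (rearrange₃ x) ⟩
    81 * (40 * (x * x) + 4 * (10 * x))       ≤⟨ *-monoʳ-≤ 81 (+-monoʳ-≤ (40 * (x * x)) (*-monoʳ-≤ 4 (*-monoˡ-≤ x 10≤x))) ⟩
    81 * (40 * (x * x) + 4 * (x * x))        ≡⟨ rearrange₄ x ⟩
    44 * (9 * x * (9 * x))                   ≤⟨ *-monoʳ-≤ 44 (*-mono-≤ 9x≤10y 9x≤10y) ⟩
    44 * (10 * y * (10 * y))                 ≤⟨ m≤m+n _ _ ⟩
    44 * (10 * y * (10 * y)) + 460 * (y * y) ≡⟨ rearrange₅ y ⟩
    810 * (6 * (y * y))                      ∎)

^-distribʳ-* : ∀ o m n → (m * n) ^ o ≡ m ^ o * n ^ o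
^-distribʳ-* zero m n = refl
^-distribʳ-* (suc o) m n = trans (cong (m * n *_) (^-distribʳ-* o m n)) (interchange m n (m ^ o) (n ^ o))
  where
  interchange : ∀ a b c d → a * b * (c * d) ≡ a * c * (b * d)
  interchange = solve-∀

-- Second moment with r = b⁵ and threshold 1 + 1. Here 2re ≤ 80000 b⁷ ≤ b⁹ ≤ n because b ≥ 300, and
-- kn ≤ 512 k b⁹ ≤ b¹⁰ = r² because n < (2b)⁹.
few-missing : ∀ {n m k b} → b ^ 9 ≤ n → n < suc b ^ 9 → 300 ≤ b → 512 * k ≤ b → m < n C 2 →
  n C 2 ∸ m ≤ 4 * (100 * b * (100 * b)) → MostlyLegal n m k
few-missing {n} {m} {k} {b} b⁹≤n n<sb⁹ b-large k-small m<N e≤ =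
  fewLargeCodegrees⇒mostlyLegal n m (b ^ 5) 1 1 k (≤-trans (m^n>0 b 9) b⁹≤n) (s≤s z≤n) sparse kn≤b¹⁰
    (λ E∈ → codegree<2⇒legalSystem E∈ m<N)
  where
  open ≤-Reasoning
  instance
    b≢0 : NonZero b
    b≢0 = >-nonZero (≤-trans (s≤s z≤n) b-large)
  rearrange₁ : ∀ r z → 2 * r * (4 * (z * z)) ≡ 8 * (z * z) * r
  rearrange₁ = solve-∀
  rearrange₂ : ∀ z → 9 * (z * z) ≡ 3 * z * (3 * z)
  rearrange₂ = solve-∀
  rearrange₃ : ∀ b r → b * b * (b * b) * r ≡ b * (b * (b * (b * r)))
  rearrange₃ = solve-∀
  rearrange₄ : ∀ k c p → k * (c * p) ≡ c * k * p
  rearrange₄ = solve-∀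
  z = 100 * b
  3z≤bb : 3 * z ≤ b * b
  3z≤bb = ≤-trans (≤-reflexive (sym (*-assoc 3 100 b))) (*-monoˡ-≤ b b-large)
  sparse : 2 * b ^ 5 * (n C 2 ∸ m) ≤ 1 * n
  sparse = begin
    2 * b ^ 5 * (n C 2 ∸ m)              ≤⟨ *-monoʳ-≤ (2 * b ^ 5) e≤ ⟩
    2 * b ^ 5 * (4 * (z * z))            ≡⟨ rearrange₁ (b ^ 5) z ⟩
    8 * (z * z) * b ^ 5                  ≤⟨ *-monoˡ-≤ (b ^ 5) (*-monoˡ-≤ (z * z) (n≤1+n 8)) ⟩
    9 * (z * z) * b ^ 5                  ≡⟨ cong (_* b ^ 5) (rearrange₂ z) ⟩
    3 * z * (3 * z) * b ^ 5              ≤⟨ *-monoˡ-≤ (b ^ 5) (*-mono-≤ 3z≤bb 3z≤bb) ⟩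
    b * b * (b * b) * b ^ 5              ≡⟨ rearrange₃ b (b ^ 5) ⟩
    b ^ 9                                ≤⟨ b⁹≤n ⟩
    n                                    ≡⟨ *-identityˡ n ⟨
    1 * n                                ∎
  kn≤b¹⁰ : k * n ≤ (b ^ 5) ^ 2
  kn≤b¹⁰ = begin
    k * n               ≤⟨ *-monoʳ-≤ k (<⇒≤ n<sb⁹) ⟩
    k * suc b ^ 9       ≤⟨ *-monoʳ-≤ k (^-monoˡ-≤ 9 (+-mono-≤ (>-nonZero⁻¹ b) (m≤m+n b 0))) ⟩
    k * (2 * b) ^ 9     ≡⟨ cong (k *_) (^-distribʳ-* 9 2 b) ⟩
    k * (512 * b ^ 9)   ≡⟨ rearrange₄ k 512 (b ^ 9) ⟩
    512 * k * b ^ 9     ≤⟨ *-monoˡ-≤ (b ^ 9) k-small ⟩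
    b ^ 10              ≡⟨ ^-*-assoc b 5 2 ⟨
    (b ^ 5) ^ 2         ∎

-- Here r = 2 and the threshold `x` is split as y + t with t = 10b. Since x ≥ 100b, y keeps nine
-- tenths of `x`, while 2^(10b) ≥ (b+1)¹⁰ ≥ kn.
many-missing : ∀ {n m k b} Δ → n < suc b ^ 9 → 0 < b → k ≤ b → 100 * (n C 2 ∸ m) ≤ n * n →
  4 * (Δ * suc Δ) < n C 2 ∸ m → n C 2 ∸ m ≤ 4 * (suc Δ * suc (suc Δ)) → 100 * b ≤ suc Δ → MostlyLegal n m k
many-missing {n} {m} {k} {b} Δ n<sb⁹ 0<b k≤b dense Δ< ≤x x-large =
  fewLargeCodegrees⇒mostlyLegal n m 2 y t k 0<n 0<y (4e≤yn {x} {y} {n} {n C 2 ∸ m} 10≤x 9x≤10y ≤x dense) kn≤2^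
    (λ {E} E∈ small → codegree≤⇒legalSystem E∈ Δ Δ< (λ v → subst (codegree E v <_) (m∸n+n≡m t≤x) (small v)))
  where
  open ≤-Reasoning
  x = suc Δ
  t = b * 10
  y = x ∸ t
  100≤x : 100 ≤ x
  100≤x = ≤-trans (*-monoʳ-≤ 100 0<b) x-large
  10≤x : 10 ≤ x
  10≤x = ≤-trans (m≤m+n 10 90) 100≤x
  10t≤x : 10 * t ≤ x
  10t≤x = ≤-trans (≤-reflexive (rearrange b)) x-large
    where
    rearrange : ∀ b → 10 * (b * 10) ≡ 100 * b
    rearrange = solve-∀
  t≤x : t ≤ x
  t≤x = ≤-trans (m≤n*m t 10) 10t≤x
  9x≤10y : 9 * x ≤ 10 * y
  9x≤10y = begin
    9 * x              ≡⟨ m+n∸m≡n x (9 * x) ⟨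
    10 * x ∸ x         ≤⟨ ∸-monoʳ-≤ (10 * x) 10t≤x ⟩
    10 * x ∸ 10 * t    ≡⟨ *-distribˡ-∸ 10 x t ⟨
    10 * y             ∎
  0<y : 0 < y
  0<y = *-cancelˡ-< 10 0 y (≤-trans (≤-trans (s≤s z≤n) (*-monoʳ-≤ 9 100≤x)) 9x≤10y)
  0<n : 0 < n
  0<n = n≢0⇒n>0 (λ { refl → <⇒≱ Δ< (≤-trans (m∸n≤m 0 m) z≤n) })
  kn≤2^ : k * n ≤ 2 ^ suc t
  kn≤2^ = begin
    k * n                  ≤⟨ *-mono-≤ (m≤n⇒m≤1+n k≤b) (<⇒≤ n<sb⁹) ⟩
    suc b ^ 10             ≤⟨ ^-monoˡ-≤ 10 (n<2^n b) ⟩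
    (2 ^ b) ^ 10           ≡⟨ ^-*-assoc 2 b 10 ⟩
    2 ^ t                  ≤⟨ ^-monoʳ-≤ 2 (n≤1+n t) ⟩
    2 ^ suc t              ∎

mostlyLegal : ∀ {n m k B} → 300 ≤ B → 512 * k ≤ B → B ^ 9 ≤ n →
  98 * (n C 2) ≤ 100 * m → m < n C 2 → MostlyLegal n m k
mostlyLegal {n} {m} {k} {B} B-large B-large′ B⁹≤n dense m<N
  with b , b⁹≤n , n<sb⁹ ← bracket (_^ 9) refl (λ b → ^-monoˡ-< 9 (n<1+n b)) n
  -- Bracketing `pred e` instead of `e` makes the lower bound on `e` strict and the upper one weak.
  with Δ , Δ≤ , <x ← bracket (λ Δ → 4 * (Δ * suc Δ)) refl
         (λ Δ → *-monoʳ-< 4 (*-mono-< (n<1+n Δ) (n<1+n (suc Δ)))) (pred (n C 2 ∸ m))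
  = conclude
  where
  open ≤-Reasoning
  e = n C 2 ∸ m
  suc-pred-e : suc (pred e) ≡ e
  suc-pred-e = suc-pred e {{≢-nonZero (m>n⇒m∸n≢0 m<N)}}
  B≤b : B ≤ b
  B≤b = ≮⇒≥ (λ b<B → <⇒≱ n<sb⁹ (≤-trans (^-monoˡ-≤ 9 b<B) B⁹≤n))
  e≤4xx′ : e ≤ 4 * (suc Δ * suc (suc Δ))
  e≤4xx′ = subst (_≤ 4 * (suc Δ * suc (suc Δ))) suc-pred-e <x
  100e≤nn : 100 * e ≤ n * n
  100e≤nn = begin
    100 * (n C 2 ∸ m)                   ≡⟨ *-distribˡ-∸ 100 (n C 2) m ⟩
    100 * (n C 2) ∸ 100 * m             ≤⟨ ∸-monoʳ-≤ (100 * (n C 2)) dense ⟩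
    100 * (n C 2) ∸ 98 * (n C 2)        ≡⟨ *-distribʳ-∸ (n C 2) 100 98 ⟨
    2 * (n C 2)                         ≡⟨ 2*nC2 n ⟩
    (n ∸ 1) * n                         ≤⟨ *-monoˡ-≤ n (m∸n≤m n 1) ⟩
    n * n                               ∎
  conclude : MostlyLegal n m k
  conclude with 100 * b ≤? suc Δ
  ... | yes x-large = many-missing {k = k} Δ n<sb⁹ (≤-trans (s≤s z≤n) (≤-trans B-large B≤b))
    (≤-trans (m≤n*m k 512) (≤-trans B-large′ B≤b)) 100e≤nn
    (subst (4 * (Δ * suc Δ) <_) suc-pred-e (s≤s Δ≤)) e≤4xx′ x-large
  -- Now `suc Δ < 100 * b`, so both factors of the upper bound on `e` are at most `100 * b`.
  ... | no x-small = few-missing {k = k} b⁹≤n n<sb⁹ (≤-trans B-large B≤b) (≤-trans B-large′ B≤b) m<N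
    (≤-trans e≤4xx′ (*-monoʳ-≤ 4 (*-mono-≤ (<⇒≤ (≰⇒> x-small)) (≰⇒> x-small))))

theorem3p1 : (m : ℕ → ℕ) →
    (∃[ N₀ ] ∀ n → N₀ ≤ n → (98 * (n C 2) ≤ 100 * m n) × (m n < n C 2)) →
    ∀ k → ∃[ N ] ∀ n → N ≤ n →
    ∃[ Good ] (Good ⊆ graphsWith n (m n)) × All HasLegalSystem Good ×
    (k * (length (graphsWith n (m n)) ∸ length Good) ≤ length (graphsWith n (m n)))
theorem3p1 m (N₀ , range) k = N₀ + B ^ 9 , λ n N≤n →
  let dense , m<N = range n (≤-trans (m≤m+n N₀ _) N≤n)
  in mostlyLegal {n} {m n} {k} {B} (m≤m+n 300 _) (m≤n+m _ 300) (≤-trans (m≤n+m (B ^ 9) N₀) N≤n) dense m<N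
  -- `B` meets both lower bounds required of the ninth root, and `B ^ 9 ≤ n` pushes that root up to
  -- at least `B`.
  where
  B = 300 + 512 * k
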